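{- For every integer $n\ge 1$, $$|\mathcal{S}_n(32;\,1\to 1)| = d_n + d_{n-1} + \sum_{m=1}^{n-1}\sum_{r=0}^{m-1}\binom{m-1}{r}\binom{n-m+r-1}{r}\, r!\; d_{m-1-r},$$ where $d_j$ denotes the $j$-th derangement number.
   Context: $[n]=\{1,\dots,n\}$, and $\mathcal{S}_n$ is the set of permutations $\pi=\pi_1\pi_2\cdots\pi_n$ of $[n]$ in one-line notation. The permutation $\hat\pi$: for $\pi\in\mathcal{S}_n$, $\hat\pi\in\mathcal{S}_n$ is the permutation whose cycle form is obtained from the word $\pi_1\cdots\pi_n$ by inserting a left parenthesis before each left-to-right maximum (an entry larger than all entries to its left) and a right parenthesis immediately before the next left-to-right maximum, or at the end of the word. A cycle $(c_1,c_2,\dots,c_s)$ means $c_1\mapsto c_2\mapsto\cdots\mapsto c_s\mapsto c_1$. Example: if $\pi=2537164$ then $\hat\pi=(2)(53)(7164)$. Arrow patterns: an arrow pattern of size $k$ is a pair $(\nu;H)$ where $\nu=\nu_1\cdots\nu_m$ is a word of distinct positive integers, $H$ is a collection of arrows $b_i\to c_i$, and the set of all integers appearing in $\nu$ or $H$ is $[k]$. A permutation $\pi\in\mathcal{S}_n$ contains $(\nu;H)$ if there are a set $X=\{x_1<x_2<\cdots<x_k\}\subseteq[n]$ and indices $t_1<\cdots<t_m$ such that $\pi_{t_1}\pi_{t_2}\cdots\pi_{t_m}=x_{\nu_1}x_{\nu_2}\cdots x_{\nu_m}$ and $\hat\pi(x_{b_i})=x_{c_i}$ for every arrow $b_i\to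 c_i$ in $H$. Otherwise $\pi$ avoids $(\nu;H)$. $\mathcal{S}_n(\nu;H)$ is the set of permutations in $\mathcal{S}_n$ avoiding $(\nu;H)$. The derangement number $d_j$ is the number of permutations of $[j]$ without fixed points ($d_0=1$, $d_1=0$). -}

module Defs where

open import Data.Fin.Base using (Fin; _<_)
open import Data.Fin.Patterns using (0F; 1F; 2F; 3F; 4F; 5F; 6F)
open import Data.Fin.Properties using (_≟_; _<?_; any?)
open import Data.List.Base as List
  using (List; []; _∷_; length; filter; allFin; cartesianProductWith; applyUpTo)
open import Data.List.NonEmpty.Base using (List⁺; _∷_)
open import Data.List.Relation.Unary.All as All using (All)
open import Data.List.Relation.Unary.Any using (Any; here; there)
open import Data.Maybe.Base using (Maybe; just; nothing; fromMaybe; _<∣>_)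
open import Data.Nat.Base using (ℕ; zero; suc; _+_; _∸_)
open import Data.Nat.ListAction using (sum)
open import Data.Product.Base using (∃; ∃-syntax; _×_; _,_)
open import Data.Sum.Base using (_⊎_; inj₁; inj₂)
open import Data.Vec.Base as Vec using (Vec; []; _∷_; lookup; toList)
open import Data.Vec.Membership.Propositional using (_∈_)
import Data.Vec.Properties as Vec
open import Data.Vec.Relation.Unary.All using ([]; _∷_)
import Data.Vec.Relation.Unary.Any as VecAny
open import Data.Vec.Relation.Unary.AllPairs using (AllPairs; []; _∷_; allPairs?)
open import Data.Vec.Relation.Unary.Unique.Propositional using (Unique)
open import Relation.Binary.PropositionalEquality.Core using (_≡_; _≢_; refl)
open import Relation.Nullary.Decidable.Core
  using (Dec; yes; no; map′; ¬?; _×-dec_)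
open import Relation.Nullary.Negation.Core using (¬_)
open import Relation.Unary using (Pred; Decidable)
open import Level using (0ℓ)

private
  variable
    k m n : ℕ

-- The sets [n] and [k] are represented by Fin n and Fin k, so every entry is
-- shifted down by one: the integer i is the element of Fin with toℕ equal to
-- i ∸ 1.

------------------------------------------------------------------------
-- Permutations in one-line notation

IsPermutation : Pred (Vec (Fin n) n) 0ℓ
IsPermutation = Unique

isPermutation? : Decidable (IsPermutation {n})
isPermutation? = allPairs? (λ i j → ¬? (i ≟ j))

words : ∀ n m → List (Vec (Fin n) m)
words n zero    = [] ∷ []
words n (suc m) = cartesianProductWith _∷_ (allFin n) (words n m)

𝒮 : ∀ n → List (Vec (Fin n) n)
𝒮 n = filter isPermutation? (words n n)

------------------------------------------------------------------------
-- The permutation π̂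

-- breakAtMaxima a w, where a is the largest entry read so far, splits w into
-- the part before its first entry larger than a, which belongs to the cycle
-- already open, and the cycles opened by the later left-to-right maxima.
breakAtMaxima : Fin n → List (Fin n) → List (Fin n) × List (List⁺ (Fin n))
breakAtMaxima a []      = [] , []
breakAtMaxima a (b ∷ w) with a <? b
... | yes _ = let (c , cs) = breakAtMaxima b w in [] , (b ∷ c) ∷ cs
... | no  _ = let (c , cs) = breakAtMaxima a w in b ∷ c , cs

cycleForm : List (Fin n) → List (List⁺ (Fin n))
cycleForm []      = []
cycleForm (a ∷ w) = let (c , cs) = breakAtMaxima a w in (a ∷ c) ∷ cs

-- The image of x under the cycle (c₁ c₂ … cₛ), or nothing if x is not in it.
cycleImage : List⁺ (Fin n) → Fin n → Maybe (Fin n)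
cycleImage {n} (c₁ ∷ cs) x = go c₁ cs
  where
  go : Fin n → List (Fin n) → Maybe (Fin n)
  go c ds with c ≟ x
  go c []       | yes _ = just c₁
  go c (d ∷ _)  | yes _ = just d
  go c []       | no  _ = nothing
  go c (d ∷ ds) | no  _ = go d ds

-- The default value is never used when π is a permutation, as then every
-- element lies in one of the cycles.
hat : Vec (Fin n) n → Fin n → Fin n
hat π x = fromMaybe x
  (List.foldr (λ c r → cycleImage c x <∣> r) nothing (cycleForm (toList π)))

private
  -- π = 2537164 has π̂ = (2)(53)(7164).
  example :
    cycleForm {7} (1F ∷ 4F ∷ 2F ∷ 6F ∷ 0F ∷ 5F ∷ 3F ∷ [])
      ≡ (1F ∷ []) ∷ (4F ∷ 2F ∷ []) ∷ (6F ∷ 0F ∷ 5F ∷ 3F ∷ []) ∷ []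
  example = refl

------------------------------------------------------------------------
-- Arrow patterns

-- The pair (b , c) in H stands for the arrow b → c.
record ArrowPattern (k : ℕ) : Set where
  field
    {size-ν} : ℕ
    ν        : Vec (Fin k) size-ν
    H        : List (Fin k × Fin k)
    distinct : Unique ν
    covers   : ∀ i → i ∈ ν ⊎ Any (λ (b , c) → i ≡ b ⊎ i ≡ c) H

Increasing : Pred (Vec (Fin n) m) 0ℓ
Increasing = AllPairs _<_

module _ (π : Vec (Fin n) n) (p : ArrowPattern k) where
  open ArrowPattern p

  Occurrence : Vec (Fin n) k → Vec (Fin n) size-ν → Set
  Occurrence x t =
      Increasing x
    × Increasing t
    × Vec.map (lookup π) t ≡ Vec.map (lookup x) ν
    × All (λ (b , c) → hat π (lookup x b) ≡ lookup x c) H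

  Contains : Set
  Contains = ∃[ x ] ∃[ t ] Occurrence x t

  Avoids : Set
  Avoids = ¬ Contains

anyVec? : {P : Pred (Vec (Fin n) m) 0ℓ} → Decidable P → Dec (∃ P)
anyVec? {m = zero}  P? = map′ ([] ,_) (λ { ([] , p) → p }) (P? [])
anyVec? {m = suc m} P? =
  map′ (λ (i , v , p) → i ∷ v , p) (λ { (i ∷ v , p) → i , v , p })
       (any? (λ i → anyVec? (λ v → P? (i ∷ v))))

avoids? : (p : ArrowPattern k) → Decidable (λ (π : Vec (Fin n) n) → Avoids π p)
avoids? p π = ¬? (anyVec? λ x → anyVec? λ t →
        allPairs? _<?_ x
  ×-dec allPairs? _<?_ t
  ×-dec Vec.≡-dec _≟_ (Vec.map (lookup π) t) (Vec.map (lookup x) ν)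
  ×-dec All.all? (λ (b , c) → hat π (lookup x b) ≟ lookup x c) H)
  where open ArrowPattern p

𝒮-avoiding : ∀ n → ArrowPattern k → List (Vec (Fin n) n)
𝒮-avoiding n p = filter (avoids? p) (𝒮 n)

-- The arrow pattern (32; 1→1).
⟨32⨾1→1⟩ : ArrowPattern 3
⟨32⨾1→1⟩ = record
  { ν        = 2F ∷ 1F ∷ []
  ; H        = (0F , 0F) ∷ []
  ; distinct = ((λ ()) ∷ []) ∷ [] ∷ []
  ; covers   = λ where
      0F → inj₂ (here (inj₁ refl))
      1F → inj₁ (VecAny.there (VecAny.here refl))
      2F → inj₁ (VecAny.here refl)
  }

------------------------------------------------------------------------
-- Derangements

IsDerangement : Pred (Vec (Fin n) n) 0ℓ
IsDerangement π = ¬ (∃[ i ] lookup π i ≡ i)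

isDerangement? : Decidable (IsDerangement {n})
isDerangement? π = ¬? (any? (λ i → lookup π i ≟ i))

d : ℕ → ℕ
d j = length (filter isDerangement? (𝒮 j))

------------------------------------------------------------------------
-- Sums

-- The sum of f i over a ≤ i ≤ b, empty when b < a.
∑ : ℕ → ℕ → (ℕ → ℕ) → ℕ
∑ a b f = sum (applyUpTo (λ i → f (a + i)) (suc b ∸ a))

infixr 5 ∑
syntax ∑ a b (λ i → e) = ∑[ i ≔ a ⋯ b ] e

{-# OPTIONS --safe #-}
module Submission where

-- Build the word of a permutation by inserting a new smallest entry again and again.
-- In front of the word, the new entry is a cycle of π̂ by itself: call it lonely.
-- Directly after y it joins the cycle of y, so that neither of the two is lonely, and
-- no other entry changes its status.  Fixed points in one-line notation obey the same
-- rule when a new smallest element is inserted into the cycles, so d n also counts the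
-- words without lonely entries.  A word avoids (32; 1→1) if and only if it has no lonely
-- entry, or the entries above its least lonely entry m increase.  In the second case it
-- is built from the increasing word m ⋯ n by insertions that are never directly after m.
-- The r entries inserted after a later place stay there, at (n − m)(n − m + 1)⋯(n − m + r − 1)
-- possible places, and do not affect the cycles in front of m, which have to become
-- d (m − 1 − r) words without lonely entries.  The insertions of the two kinds are
-- shuffled in C(m − 1, r) ways.

open import Defs
open import Data.Nat using (ℕ; _≤_; _+_; _∸_; _*_; _!)
open import Data.Nat.Combinatorics using (_C_)
open import Data.List using (length)
open import Relation.Binary.PropositionalEquality using (_≡_)

open import Data.Bool.Base using (Bool; true; false; if_then_else_; _∨_)
open import Data.Bool.ListAction using (any)
import Data.Bool.Properties as Bool
open import Data.Empty using (⊥-elim)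
open import Data.Fin.Base using (Fin; zero; suc; toℕ) renaming (_<_ to _<ᶠ_)
open import Data.Fin.Properties as Fin
  using (_≟_; _<?_; all?; pigeonhole; 0≢1+n; <-trans; <-asym)
open import Data.List.Base
  using (List; []; _∷_; _++_; map; filter; foldr; concatMap; tabulate; allFin; applyUpTo)
open import Data.List.Membership.Propositional using (_∈_; _∉_; find; lose)
open import Data.List.Membership.Propositional.Properties
  using (∈-++⁺ˡ; ∈-++⁺ʳ; ∈-++⁻; ∈-map⁺; ∈-map⁻; ∈-concatMap⁺; ∈-concatMap⁻; ∈-filter⁺; ∈-filter⁻;
    ∈-cartesianProductWith⁺; ∈-allFin)
open import Data.List.Membership.Propositional.Properties.WithK using (unique∧set⇒bag)
open import Data.List.NonEmpty.Base using (List⁺; _∷_)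
open import Data.List.Properties as List using (map-++; map-∘; map-tabulate; length-map)
open import Data.List.Relation.Binary.BagAndSetEquality using (∼bag⇒↭)
open import Data.List.Relation.Binary.Permutation.Propositional using (_↭_)
import Data.List.Relation.Binary.Permutation.Propositional.Properties as ↭
open import Data.List.Relation.Unary.All as All using (All; []; _∷_)
import Data.List.Relation.Unary.All.Properties as All
open import Data.List.Relation.Unary.AllPairs using ([]; _∷_)
open import Data.List.Relation.Unary.Any as Any using (here; there)
open import Data.List.Relation.Unary.Unique.Propositional using (Unique)
import Data.List.Relation.Unary.Unique.Propositional.Properties as Unique
open import Data.Maybe.Base using (Maybe; just; nothing; fromMaybe; _<∣>_)
open import Data.Nat.Base hiding (_≤_; _+_; _∸_; _*_; _!; ℕ)
open import Data.Nat.Combinatorics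
  using (nCk+nC[k+1]≡[n+1]C[k+1]; nCk≡n!/k![n-k]!; k>n⇒nCk≡0; k![n∸k]!∣n!)
open import Data.Nat.DivMod using (m/n*n≡m)
open import Data.Nat.ListAction using (sum)
open import Data.Nat.ListAction.Properties using (sum-++; sum-↭)
open import Data.Nat.Properties as ℕ
  using (*-assoc; *-cancelʳ-≡; *-comm; *-distribˡ-+; *-identityʳ; *-identityˡ; *-zeroʳ;
    +-assoc; +-comm; +-identityʳ; +-suc; +-∸-assoc; _!*_!≢0; _!≢0; m+n∸n≡m; m+n≡0⇒m≡0;
    m+n≡0⇒n≡0; m<n⇒0<n∸m; m≤n+m; n<1+n; n∸n≡0; ≤-<-trans; ≤-pred; ≮⇒≥)
open import Data.Nat.Tactic.RingSolver using (solve-∀)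
open import Data.Product.Base using (∃-syntax; _×_; _,_; proj₁; proj₂)
open import Data.Sum.Base using (_⊎_; inj₁; inj₂)
open import Data.Vec.Base as Vec using (Vec; []; _∷_; lookup; toList; fromList)
open import Data.Vec.Properties as Vec using (∷-injective; lookup-map)
import Data.Vec.Relation.Unary.All as VecAll
import Data.Vec.Relation.Unary.All.Properties as VecAll
import Data.Vec.Relation.Unary.AllPairs as VecAllPairs
import Data.Vec.Relation.Unary.Unique.Propositional as Vec
import Data.Vec.Relation.Unary.Unique.Propositional.Properties as VecUnique
open import Function.Base using (_∘_; id; case_of_)
open import Function.Bundles using (mk⇔)
open import Relation.Binary.PropositionalEquality
  using (_≢_; refl; sym; trans; cong; cong₂; subst; module ≡-Reasoning)
open import Relation.Nullary using (Dec; yes; no; ¬_; does; map′; _×-dec_; _→-dec_)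
open import Relation.Unary using (Pred; Decidable)

-- A partial word cannot simply be counted, because loneliness is not final: a lonely entry loses it
-- when a smaller entry is put directly after it. So every partial word is weighted by the number
-- `W` of ways to finish it without lonely entries, and this number depends only on how many entries
-- have each colour. Carrying out one insertion and having one less to go leaves the total weight
-- unchanged, so the total can be pushed back to the smallest word, where it is a single value of
-- `W`. Permutations under cycle insertion and words under word insertion reach the same value, so
-- no bijection between them is constructed. The condition that the pivot `m` be the least lonely
-- entry cannot be imposed along the way either. A partial word may have smaller lonely entries in
-- front of `m`; the weight makes them disappear in the end. For a word avoiding the pattern the
-- least lonely entry is unique if it exists, which makes the count a sum over `m`. The case of `m`
-- the largest entry has no place after the pivot and yields the separate derangement number of
-- index one less.

private
  variable
    A B : Set
    k n : ℕ


-- Indicators and finite sums.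

ind : {P : Set} → Dec P → ℕ
ind P? = if does P? then 1 else 0

ind-cong : {P Q : Set} (P? : Dec P) (Q? : Dec Q) → (P → Q) → (Q → P) → ind P? ≡ ind Q?
ind-cong (yes _) (yes _) _   _   = refl
ind-cong (yes p) (no ¬q) p⇒q _   = ⊥-elim (¬q (p⇒q p))
ind-cong (no ¬p) (yes q) _   q⇒p = ⊥-elim (¬p (q⇒p q))
ind-cong (no _)  (no _)  _   _   = refl

ind-yes : {P : Set} (P? : Dec P) → P → ind P? ≡ 1
ind-yes (yes _) _ = refl
ind-yes (no ¬p) p = ⊥-elim (¬p p)

ind-no : {P : Set} (P? : Dec P) → ¬ P → ind P? ≡ 0
ind-no (yes p) ¬p = ⊥-elim (¬p p)
ind-no (no _)  _  = refl

ind-0∨1 : {P : Set} (P? : Dec P) → ind P? ≡ 0 ⊎ ind P? ≡ 1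
ind-0∨1 (yes _) = inj₂ refl
ind-0∨1 (no _)  = inj₁ refl

sumOver : List A → (A → ℕ) → ℕ
sumOver xs f = sum (map f xs)

sumFin : (Fin n → ℕ) → ℕ
sumFin f = sum (tabulate f)

length-filter≡sumOver : {P : Pred A _} (P? : Decidable P) (xs : List A) →
  length (filter P? xs) ≡ sumOver xs (ind ∘ P?)
length-filter≡sumOver P? [] = refl
length-filter≡sumOver P? (x ∷ xs) with P? x
... | yes _ = cong suc (length-filter≡sumOver P? xs)
... | no  _ = length-filter≡sumOver P? xs

sumOver-cong : (xs : List A) {f g : A → ℕ} → (∀ {x} → x ∈ xs → f x ≡ g x) →
  sumOver xs f ≡ sumOver xs g
sumOver-cong []       f≗g = refl
sumOver-cong (x ∷ xs) f≗g =
  cong₂ _+_ (f≗g (here refl)) (sumOver-cong xs (f≗g ∘ there))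

sumFin-cong : ∀ {n} {f g : Fin n → ℕ} → (∀ i → f i ≡ g i) → sumFin f ≡ sumFin g
sumFin-cong {zero}  f≗g = refl
sumFin-cong {suc n} f≗g = cong₂ _+_ (f≗g zero) (sumFin-cong (f≗g ∘ suc))

sumFin-0 : ∀ n → sumFin {n} (λ _ → 0) ≡ 0
sumFin-0 zero    = refl
sumFin-0 (suc n) = sumFin-0 n

+-interchange : ∀ a b c d → (a + b) + (c + d) ≡ (a + c) + (b + d)
+-interchange = solve-∀

sumFin-+ : ∀ {n} (f g : Fin n → ℕ) → sumFin (λ i → f i + g i) ≡ sumFin f + sumFin g
sumFin-+ {zero}  f g = refl
sumFin-+ {suc n} f g =
  trans (cong (f zero + g zero +_) (sumFin-+ (f ∘ suc) (g ∘ suc)))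
        (+-interchange (f zero) (g zero) _ _)

sumOver-+ : (xs : List A) (f g : A → ℕ) →
  sumOver xs (λ x → f x + g x) ≡ sumOver xs f + sumOver xs g
sumOver-+ []       f g = refl
sumOver-+ (x ∷ xs) f g =
  trans (cong (f x + g x +_) (sumOver-+ xs f g)) (+-interchange (f x) (g x) _ _)

sumOver-sumFin : ∀ {n} (xs : List A) (f : A → Fin n → ℕ) →
  sumOver xs (λ x → sumFin (f x)) ≡ sumFin (λ i → sumOver xs (λ x → f x i))
sumOver-sumFin {n = n} []       f = sym (sumFin-0 n)
sumOver-sumFin         (x ∷ xs) f =
  trans (cong (sumFin (f x) +_) (sumOver-sumFin xs f)) (sym (sumFin-+ (f x) _))

sumOver-map : (g : A → B) (xs : List A) (f : B → ℕ) →
  sumOver (map g xs) f ≡ sumOver xs (f ∘ g)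
sumOver-map g xs f = cong sum (sym (map-∘ xs))

sumOver-allFin : ∀ n (f : Fin n → ℕ) → sumOver (allFin n) f ≡ sumFin f
sumOver-allFin n f = cong sum (map-tabulate id f)

sumOver-concatMap : (g : A → List B) (xs : List A) (f : B → ℕ) →
  sumOver (concatMap g xs) f ≡ sumOver xs (λ x → sumOver (g x) f)
sumOver-concatMap g []       f = refl
sumOver-concatMap g (x ∷ xs) f = begin
  sum (map f (g x ++ concatMap g xs))           ≡⟨ cong sum (map-++ f (g x) _) ⟩
  sum (map f (g x) ++ map f (concatMap g xs))   ≡⟨ sum-++ (map f (g x)) _ ⟩
  sumOver (g x) f + sumOver (concatMap g xs) f  ≡⟨ cong (sumOver (g x) f +_) (sumOver-concatMap g xs f) ⟩
  sumOver (g x) f + sumOver xs (λ y → sumOver (g y) f) ∎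
  where open ≡-Reasoning

-- Generating the objects of the next size from their parents.

concatMap-unique : (g : A → List B) →
  (∀ {x y z} → z ∈ g x → z ∈ g y → x ≡ y) → (xs : List A) →
  (∀ {x} → x ∈ xs → Unique (g x)) → Unique xs → Unique (concatMap g xs)
concatMap-unique g disjoint []       _  _  = []
concatMap-unique g disjoint (x ∷ xs) g! (x∉xs ∷ xs!) =
  Unique.++⁺ (g! (here refl)) (concatMap-unique g disjoint xs (g! ∘ there) xs!)
    λ (z∈gx , z∈rest) → let (y , y∈xs , z∈gy) = find (∈-concatMap⁻ g {xs = xs} z∈rest) in
      All.lookup x∉xs y∈xs (disjoint z∈gx z∈gy)

module Children
  {A B : Set} {n} (front : A → B) (insert : Fin n → A → B)
  where

  children : A → List B
  children x = front x ∷ map (λ y → insert y x) (allFin n)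

  -- Duplicate-free lists with the same members are permutations of each other, so their sums agree
  -- whatever the order of enumeration. Distinct children are required only of members of `xs`,
  -- since inserting after an absent entry adds nothing to a word.
  sumOver-children : {xs : List A} {ys : List B} → Unique xs → Unique ys →
    (∀ {x y z} → z ∈ children x → z ∈ children y → x ≡ y) →
    (∀ {x} → x ∈ xs → Unique (children x)) →
    (∀ {x z} → x ∈ xs → z ∈ children x → z ∈ ys) →
    (∀ {z} → z ∈ ys → ∃[ x ] x ∈ xs × z ∈ children x) →
    (f : B → ℕ) →
    sumOver ys f ≡ sumOver xs (λ x → f (front x) + sumFin (λ y → f (insert y x)))
  sumOver-children {xs} {ys} xs! ys! disjoint children! sound complete f = begin
    sumOver ys f                                ≡⟨ sum-↭ (↭.map⁺ f ys↭) ⟩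
    sumOver (concatMap children xs) f           ≡⟨ sumOver-concatMap children xs f ⟩
    sumOver xs (λ x → sumOver (children x) f)   ≡⟨ sumOver-cong xs (λ {x} _ → cong (f (front x) +_) (expand x)) ⟩
    sumOver xs (λ x → f (front x) + sumFin (λ y → f (insert y x))) ∎
    where
    open ≡-Reasoning
    ys↭ : ys ↭ concatMap children xs
    ys↭ = ∼bag⇒↭ (unique∧set⇒bag ys! (concatMap-unique children disjoint xs children! xs!)
      (mk⇔ (λ z∈ → let (x , x∈ , z∈x) = complete z∈ in ∈-concatMap⁺ children (lose x∈ z∈x))
           (λ z∈ → let (x , x∈ , z∈x) = find (∈-concatMap⁻ children {xs = xs} z∈) in sound x∈ z∈x)))
    expand : ∀ x → sumOver (map (λ y → insert y x) (allFin n)) f ≡ sumFin (λ y → f (insert y x))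
    expand x = trans (sumOver-map (λ y → insert y x) (allFin n) f) (sumOver-allFin n _)

  ∈-children⁻ : ∀ {x z} → z ∈ children x → z ≡ front x ⊎ ∃[ y ] z ≡ insert y x
  ∈-children⁻ (here z≡)  = inj₁ z≡
  ∈-children⁻ {x} (there z∈) = let (y , _ , z≡) = ∈-map⁻ (λ y → insert y x) z∈ in inj₂ (y , z≡)

  ∈-children-front : ∀ x → front x ∈ children x
  ∈-children-front x = here refl

  ∈-children-insert : ∀ x y → insert y x ∈ children x
  ∈-children-insert x y = there (∈-map⁺ _ (∈-allFin y))

  children-unique : ∀ {x} → (∀ y → front x ≢ insert y x) →
    (∀ {y z} → insert y x ≡ insert z x → y ≡ z) → Unique (children x)
  children-unique {x} front≢insert insert-injective =
    All.tabulate (λ z∈ → let (y , _ , z≡) = ∈-map⁻ (λ y → insert y x) z∈ in λ e → front≢insert y (trans e z≡))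
    ∷ Unique.map⁺ insert-injective (Unique.allFin⁺ n)

-- Colours, weights and their recursion.

-- In a structure without a pivot, every element that is not lonely is coloured before.
data Colour : Set where
  pivot lonely before after : Colour

δ : Colour → Colour → ℕ
δ pivot  pivot  = 1
δ lonely lonely = 1
δ before before = 1
δ after  after  = 1
δ _      _      = 0

count : Colour → (Fin n → Colour) → ℕ
count c χ = sumFin (λ i → δ (χ i) c)

count-cong : ∀ c {χ ψ : Fin n → Colour} → (∀ i → χ i ≡ ψ i) → count c χ ≡ count c ψ
count-cong c χ≗ψ = sumFin-cong (λ i → cong (λ e → δ e c) (χ≗ψ i))

-- The number of ways to insert t further smallest elements, one at a time, into
-- an object with k lonely elements, b elements before and q elements after the
-- pivot, so that no lonely element remains.
W : (t k b q : ℕ) → ℕ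
W zero    zero    b q = 1
W zero    (suc _) b q = 0
W (suc t) k       b q =
  W t (suc k) b q + (k * W t (pred k) (2 + b) q + b * W t k (suc b) q + q * W t k b (suc q))

weight : ℕ → (Fin n → Colour) → ℕ
weight t χ = W t (count lonely χ) (count before χ) (count after χ)

-- After an insertion behind `y`, the new element and `y` lie in one cycle, so both get this colour.
-- With a pivot, only elements in front of it are ever coloured `lonely`, whence `before`.
descend : Colour → Colour
descend lonely = before
descend c      = c

-- χ′ arises from χ by inserting a new smallest element directly after y.
record Inserted (χ : Fin n → Colour) (y : Fin n) (χ′ : Fin (suc n) → Colour) : Set where
  field
    new   : χ′ zero ≡ descend (χ y)
    self  : χ′ (suc y) ≡ descend (χ y)
    other : ∀ x → x ≢ y → χ′ (suc x) ≡ χ x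

-- The two sums differ in the term at `y` alone; adding on both sides avoids truncated subtraction.
sumFin-update : ∀ {n} (f g : Fin n → ℕ) y → (∀ x → x ≢ y → g x ≡ f x) →
  sumFin g + f y ≡ sumFin f + g y
sumFin-update f g zero eq = begin
  g zero + sumFin (g ∘ suc) + f zero  ≡⟨ cong (λ s → g zero + s + f zero) (sumFin-cong (λ x → eq (suc x) λ ())) ⟩
  g zero + sumFin (f ∘ suc) + f zero  ≡⟨ swap (g zero) _ (f zero) ⟩
  f zero + sumFin (f ∘ suc) + g zero  ∎
  where
  open ≡-Reasoning
  swap : ∀ a b c → a + b + c ≡ c + b + a
  swap = solve-∀
sumFin-update f g (suc y) eq = begin
  g zero + sumFin (g ∘ suc) + f (suc y)    ≡⟨ +-assoc (g zero) _ _ ⟩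
  g zero + (sumFin (g ∘ suc) + f (suc y))  ≡⟨ cong₂ _+_ (eq zero λ ())
      (sumFin-update (f ∘ suc) (g ∘ suc) y (λ x x≢y → eq (suc x) (x≢y ∘ Fin.suc-injective))) ⟩
  f zero + (sumFin (f ∘ suc) + g (suc y))  ≡⟨ +-assoc (f zero) _ _ ⟨
  f zero + sumFin (f ∘ suc) + g (suc y)    ∎
  where open ≡-Reasoning

-- One element of the colour of `y` is lost and two of the descended colour are gained: `y` itself
-- and the new element.
count-inserted : ∀ {χ : Fin n → Colour} {y χ′} → Inserted χ y χ′ → ∀ c →
  count c χ′ + δ (χ y) c ≡ δ (descend (χ y)) c + (count c χ + δ (descend (χ y)) c)
count-inserted {χ = χ} {y} {χ′} ins c = begin
  δ (χ′ zero) c + count c (χ′ ∘ suc) + δ (χ y) c    ≡⟨ +-assoc (δ (χ′ zero) c) _ _ ⟩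
  δ (χ′ zero) c + (count c (χ′ ∘ suc) + δ (χ y) c)  ≡⟨ cong (δ (χ′ zero) c +_)
      (sumFin-update (λ x → δ (χ x) c) _ y (λ x x≢y → cong (λ e → δ e c) (other x x≢y))) ⟩
  δ (χ′ zero) c + (count c χ + δ (χ′ (suc y)) c)    ≡⟨ cong₂ (λ d e → δ d c + (count c χ + δ e c)) new self ⟩
  δ (descend (χ y)) c + (count c χ + δ (descend (χ y)) c) ∎
  where
  open ≡-Reasoning
  open Inserted ins

-- These are the values in the products of the recursion for `W`. A lonely `y` moves to `before`
-- together with the new element, hence `2 + b`.
weight-inserted : ∀ t {χ : Fin n → Colour} {y χ′} → Inserted χ y χ′ → 
  let k = count lonely χ ; b = count before χ ; q = count after χ in
  (χ y ≡ lonely → weight t χ′ ≡ W t (pred k) (2 + b) q) ×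
  (χ y ≡ before → weight t χ′ ≡ W t k (suc b) q) ×
  (χ y ≡ after  → weight t χ′ ≡ W t k b (suc q))
weight-inserted t {χ} {y} {χ′} ins = isLonely , isBefore , isAfter
  where
  cong₃ : ∀ {k k′ b b′ q q′} → k ≡ k′ → b ≡ b′ → q ≡ q′ → W t k b q ≡ W t k′ b′ q′
  cong₃ refl refl refl = refl
  -- Once the colour of `y` is known, each `δ` in `count-inserted` computes to 0 or 1. The four
  -- helpers solve the four equations that can arise.
  plain : ∀ {a b} → a + 0 ≡ 0 + (b + 0) → a ≡ b
  plain {a} {b} eq = trans (sym (+-identityʳ a)) (trans eq (+-identityʳ b))
  drop-one : ∀ {a b} → a + 1 ≡ 0 + (b + 0) → a ≡ pred b
  drop-one {a} {b} eq = cong pred (trans (+-comm 1 a) (trans eq (+-identityʳ b)))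
  add-two : ∀ {a b} → a + 0 ≡ 1 + (b + 1) → a ≡ 2 + b
  add-two {a} {b} eq = trans (sym (+-identityʳ a)) (trans eq (cong suc (+-comm b 1)))
  add-one : ∀ {a b} → a + 1 ≡ 1 + (b + 1) → a ≡ 1 + b
  add-one {a} {b} eq = ℕ.suc-injective (trans (+-comm 1 a) (trans eq (cong suc (+-comm b 1))))
  eqs : ∀ {c} → χ y ≡ c → ∀ e → count e χ′ + δ c e ≡ δ (descend c) e + (count e χ + δ (descend c) e)
  eqs refl = count-inserted ins
  isLonely : χ y ≡ lonely → _
  isLonely e = cong₃ (drop-one (eqs e lonely)) (add-two (eqs e before)) (plain (eqs e after))
  isBefore : χ y ≡ before → _
  isBefore e = cong₃ (plain (eqs e lonely)) (add-one (eqs e before)) (plain (eqs e after))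
  isAfter : χ y ≡ after → _
  isAfter e = cong₃ (plain (eqs e lonely)) (plain (eqs e before)) (add-one (eqs e after))

sumFin-colour : ∀ {n} (χ : Fin n → Colour) (g : Colour → ℕ) → sumFin (g ∘ χ) ≡
  count pivot χ * g pivot + (count lonely χ * g lonely + count before χ * g before + count after χ * g after)
sumFin-colour {zero}  χ g = refl
sumFin-colour {suc n} χ g with χ zero | sumFin-colour (χ ∘ suc) g
... | pivot  | eq = trans (cong (g pivot +_) eq) (sym (+-assoc (g pivot) _ _))
... | lonely | eq = trans (cong (g lonely +_) eq)
  (move (g lonely) (term pivot) (term lonely) (term before) (term after))
  where
  term : Colour → ℕ
  term c = count c (χ ∘ suc) * g c
  move : ∀ x p a b c → x + (p + (a + b + c)) ≡ p + (x + a + b + c)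
  move = solve-∀
... | before | eq = trans (cong (g before +_) eq)
  (move (g before) (term pivot) (term lonely) (term before) (term after))
  where
  term : Colour → ℕ
  term c = count c (χ ∘ suc) * g c
  move : ∀ x p a b c → x + (p + (a + b + c)) ≡ p + (a + (x + b) + c)
  move = solve-∀
... | after  | eq = trans (cong (g after +_) eq)
  (move (g after) (term pivot) (term lonely) (term before) (term after))
  where
  term : Colour → ℕ
  term c = count c (χ ∘ suc) * g c
  move : ∀ x p a b c → x + (p + (a + b + c)) ≡ p + (a + b + (x + c))
  move = solve-∀

-- This is the recursion of `W` read on a structure: insertion at the front gives `χ₀`, and the
-- value `f y` of an insertion after `y` depends on the colour of `y` alone. Grouping the `y` by
-- colour yields the factors `k`, `b` and `q`; the pivot contributes 0, as nothing may be inserted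
-- directly after it.
weight-suc : ∀ t (χ : Fin n → Colour) (χ₀ : Fin (suc n) → Colour) (f : Fin n → ℕ) →
  χ₀ zero ≡ lonely → (∀ x → χ₀ (suc x) ≡ χ x) →
  (∀ y → χ y ≡ pivot → f y ≡ 0) →
  (∀ y → χ y ≢ pivot → ∃[ χ′ ] Inserted χ y χ′ × f y ≡ weight t χ′) →
  weight (suc t) χ ≡ weight t χ₀ + sumFin f
weight-suc t χ χ₀ f new old dead inserted =
  cong₂ _+_ atFront (sym (trans (sumFin-cong f≗g∘χ) (trans (sumFin-colour χ g)
    (cong (_+ (count lonely χ * g lonely + count before χ * g before + count after χ * g after))
      (*-zeroʳ (count pivot χ))))))
  where
  g : Colour → ℕ
  g pivot  = 0
  g lonely = W t (pred (count lonely χ)) (2 + count before χ) (count after χ)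
  g before = W t (count lonely χ) (suc (count before χ)) (count after χ)
  g after  = W t (count lonely χ) (count before χ) (suc (count after χ))
  oldCount : ∀ c → count c (χ₀ ∘ suc) ≡ count c χ
  oldCount c = count-cong c old
  atFront : W t (suc (count lonely χ)) (count before χ) (count after χ) ≡ weight t χ₀
  atFront rewrite new | oldCount lonely | oldCount before | oldCount after = refl
  f≗g∘χ : ∀ y → f y ≡ g (χ y)
  f≗g∘χ y with χ y in eq
  ... | pivot  = dead y eq
  ... | lonely = let (_ , ins , fy) = inserted y (λ e → case trans (sym eq) e of λ ()) in
    trans fy (proj₁ (weight-inserted t ins) eq)
  ... | before = let (_ , ins , fy) = inserted y (λ e → case trans (sym eq) e of λ ()) in
    trans fy (proj₁ (proj₂ (weight-inserted t ins)) eq)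
  ... | after  = let (_ , ins , fy) = inserted y (λ e → case trans (sym eq) e of λ ()) in
    trans fy (proj₂ (proj₂ (weight-inserted t ins)) eq)

-- Binomial convolution

sumUpTo : ℕ → (ℕ → ℕ) → ℕ
sumUpTo n f = sum (applyUpTo f n)

sumUpTo-cong : ∀ n {f g : ℕ → ℕ} → (∀ i → i < n → f i ≡ g i) → sumUpTo n f ≡ sumUpTo n g
sumUpTo-cong zero    eq = refl
sumUpTo-cong (suc n) eq = cong₂ _+_ (eq 0 z<s) (sumUpTo-cong n (λ i i<n → eq (suc i) (s<s i<n)))

sumUpTo-+ : ∀ n (f g : ℕ → ℕ) → sumUpTo n (λ i → f i + g i) ≡ sumUpTo n f + sumUpTo n g
sumUpTo-+ zero    f g = refl
sumUpTo-+ (suc n) f g =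
  trans (cong (f 0 + g 0 +_) (sumUpTo-+ n (f ∘ suc) (g ∘ suc))) (+-interchange (f 0) (g 0) _ _)

sumUpTo-last : ∀ n (f : ℕ → ℕ) → sumUpTo (suc n) f ≡ sumUpTo n f + f n
sumUpTo-last zero    f = +-identityʳ (f 0)
sumUpTo-last (suc n) f = trans (cong (f 0 +_) (sumUpTo-last n (f ∘ suc))) (sym (+-assoc (f 0) _ _))

sumFin-toℕ : ∀ n (f : ℕ → ℕ) → sumFin {n} (f ∘ toℕ) ≡ sumUpTo n f
sumFin-toℕ zero    f = refl
sumFin-toℕ (suc n) f = cong (f 0 +_) (sumFin-toℕ n (f ∘ suc))

-- The sum over all interleavings of `r` steps of one kind with `s ∸ r` of another, of weight
-- `R r * G (s ∸ r)`. The clauses choose the kind of the first step, which makes it fit the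
-- recursion of `W`.
shuffle : ℕ → (R G : ℕ → ℕ) → ℕ
shuffle zero    R G = R 0 * G 0
shuffle (suc s) R G = shuffle s (R ∘ suc) G + shuffle s R (G ∘ suc)

shuffle≡sum : ∀ s R G → shuffle s R G ≡ sumUpTo (suc s) (λ r → (s C r) * R r * G (s ∸ r))
shuffle≡sum zero    R G = trans (cong (_* G 0) (sym (*-identityˡ (R 0)))) (sym (+-identityʳ _))
shuffle≡sum (suc s) R G = begin
  shuffle s (R ∘ suc) G + shuffle s R (G ∘ suc)
    ≡⟨ cong₂ _+_ (shuffle≡sum s (R ∘ suc) G) (shuffle≡sum s R (G ∘ suc)) ⟩
  X + sumUpTo (suc s) (λ r → (s C r) * R r * G (suc (s ∸ r)))
    -- Here `r ≤ s` is essential: only then is `suc (s ∸ r)` equal to `suc s ∸ r`.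
    ≡⟨ cong (X +_) (sumUpTo-cong (suc s) (λ r r<1+s →
         cong (λ e → (s C r) * R r * G e) (sym (+-∸-assoc 1 (≤-pred r<1+s))))) ⟩
  X + sumUpTo (suc s) Y
    ≡⟨ cong (X +_) (+-identityʳ _) ⟨
  X + (sumUpTo (suc s) Y + 0)
    -- A vanishing term is appended, by `s C suc s = 0`. Splitting off the term at 0 instead of the
    -- last one then leaves `Z` with the same range as `X`, ready for Pascal's rule.
    ≡⟨ cong (λ e → X + (sumUpTo (suc s) Y + e * R (suc s) * G (s ∸ s))) (k>n⇒nCk≡0 (n<1+n s)) ⟨
  X + (sumUpTo (suc s) Y + Y (suc s))
    ≡⟨ cong (X +_) (sumUpTo-last (suc s) Y) ⟨
  X + (Y 0 + Z)
    ≡⟨ rearrange X (Y 0) Z ⟩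
  Y 0 + (X + Z)
    ≡⟨ cong (Y 0 +_) (sumUpTo-+ (suc s)
         (λ r → (s C r) * R (suc r) * G (s ∸ r)) (λ r → (s C suc r) * R (suc r) * G (s ∸ r))) ⟨
  Y 0 + sumUpTo (suc s) (λ r → (s C r) * R (suc r) * G (s ∸ r) + (s C suc r) * R (suc r) * G (s ∸ r))
    ≡⟨ cong (Y 0 +_) (sumUpTo-cong (suc s) (λ r _ → pascal r)) ⟩
  Y 0 + sumUpTo (suc s) (λ r → (suc s C suc r) * R (suc r) * G (s ∸ r)) ∎
  where
  open ≡-Reasoning
  X = sumUpTo (suc s) (λ r → (s C r) * R (suc r) * G (s ∸ r))
  Y = λ r → (s C r) * R r * G (suc s ∸ r)
  Z = sumUpTo (suc s) (λ r → (s C suc r) * R (suc r) * G (s ∸ r))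
  rearrange : ∀ a b c → a + (b + c) ≡ b + (a + c)
  rearrange = solve-∀
  factor : ∀ a b c d → a * c * d + b * c * d ≡ (a + b) * c * d
  factor = solve-∀
  pascal : ∀ r → (s C r) * R (suc r) * G (s ∸ r) + (s C suc r) * R (suc r) * G (s ∸ r)
    ≡ (suc s C suc r) * R (suc r) * G (s ∸ r)
  pascal r = trans (factor (s C r) (s C suc r) (R (suc r)) (G (s ∸ r)))
    (cong (λ e → e * R (suc r) * G (s ∸ r)) (nCk+nC[k+1]≡[n+1]C[k+1] s r))

shuffle-cong : ∀ s {R R′ G G′} → (∀ i → R i ≡ R′ i) → (∀ i → G i ≡ G′ i) → shuffle s R G ≡ shuffle s R′ G′
shuffle-cong zero    R≗ G≗ = cong₂ _*_ (R≗ 0) (G≗ 0)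
shuffle-cong (suc s) R≗ G≗ = cong₂ _+_ (shuffle-cong s (R≗ ∘ suc) G≗) (shuffle-cong s R≗ (G≗ ∘ suc))

shuffle-*ˡ : ∀ s c R G → shuffle s (λ i → c * R i) G ≡ c * shuffle s R G
shuffle-*ˡ zero    c R G = *-assoc c (R 0) (G 0)
shuffle-*ˡ (suc s) c R G =
  trans (cong₂ _+_ (shuffle-*ˡ s c (R ∘ suc) G) (shuffle-*ˡ s c R (G ∘ suc))) (sym (*-distribˡ-+ c _ _))

shuffle-*ʳ : ∀ s c R G → shuffle s R (λ i → c * G i) ≡ c * shuffle s R G
shuffle-*ʳ zero    c R G = swap (R 0) c (G 0)
  where swap : ∀ a b c → a * (b * c) ≡ b * (a * c)
        swap = solve-∀
shuffle-*ʳ (suc s) c R G =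
  trans (cong₂ _+_ (shuffle-*ʳ s c (R ∘ suc) G) (shuffle-*ʳ s c R (G ∘ suc))) (sym (*-distribˡ-+ c _ _))

shuffle-+ʳ : ∀ s R G H → shuffle s R (λ i → G i + H i) ≡ shuffle s R G + shuffle s R H
shuffle-+ʳ zero    R G H = *-distribˡ-+ (R 0) (G 0) (H 0)
shuffle-+ʳ (suc s) R G H =
  trans (cong₂ _+_ (shuffle-+ʳ s (R ∘ suc) G H) (shuffle-+ʳ s R (G ∘ suc) (H ∘ suc)))
    (+-interchange (shuffle s (R ∘ suc) G) _ _ _)

-- The rising factorial q (q + 1) ⋯ (q + r - 1): every entry inserted after the pivot offers one
-- more place to the next.
rising : ℕ → ℕ → ℕ
rising q zero    = 1
rising q (suc r) = q * rising (suc q) r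

-- An insertion after the pivot changes only `q`, and the others change only `k` and `b`, so the two
-- kinds of insertion do not interact. The first kind accounts for `rising q`; the second is `W`
-- with nothing after the pivot.
W-shuffle : ∀ s k b q → W s k b q ≡ shuffle s (rising q) (λ i → W i k b 0)
W-shuffle zero    zero    b q = refl
W-shuffle zero    (suc k) b q = refl
W-shuffle (suc s) k       b q = begin
  W s (suc k) b q + (k * W s (pred k) (2 + b) q + b * W s k (suc b) q + q * W s k b (suc q))
    ≡⟨ cong₂ _+_ (W-shuffle s (suc k) b q) (cong₂ _+_
         (cong₂ _+_ (cong (k *_) (W-shuffle s (pred k) (2 + b) q)) (cong (b *_) (W-shuffle s k (suc b) q)))
         (cong (q *_) (W-shuffle s k b (suc q)))) ⟩
  S G₁ + (k * S G₂ + b * S G₃ + q * shuffle s (rising (suc q)) G)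
    ≡⟨ rearrange (S G₁) (k * S G₂) (b * S G₃) (q * shuffle s (rising (suc q)) G) ⟩
  q * shuffle s (rising (suc q)) G + (S G₁ + (k * S G₂ + b * S G₃ + 0))
    ≡⟨ cong₂ _+_ (shuffle-*ˡ s q (rising (suc q)) G) later ⟨
  shuffle s (λ i → q * rising (suc q) i) G + S (λ i → W (suc i) k b 0) ∎
  where
  open ≡-Reasoning
  S = shuffle s (rising q)
  G  = λ i → W i k b 0
  G₁ = λ i → W i (suc k) b 0
  G₂ = λ i → W i (pred k) (2 + b) 0
  G₃ = λ i → W i k (suc b) 0
  rearrange : ∀ a b c d → a + (b + c + d) ≡ d + (a + (b + c + 0))
  rearrange = solve-∀
  later : S (λ i → W (suc i) k b 0) ≡ S G₁ + (k * S G₂ + b * S G₃ + 0)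
  later = begin
    S (λ i → G₁ i + (k * G₂ i + b * G₃ i + 0))
      ≡⟨ shuffle-+ʳ s (rising q) G₁ _ ⟩
    S G₁ + S (λ i → k * G₂ i + b * G₃ i + 0)
      ≡⟨ cong (S G₁ +_) (shuffle-cong s (λ _ → refl) (λ i → +-identityʳ _)) ⟩
    S G₁ + S (λ i → k * G₂ i + b * G₃ i)
      ≡⟨ cong (S G₁ +_) (shuffle-+ʳ s (rising q) _ _) ⟩
    S G₁ + (S (λ i → k * G₂ i) + S (λ i → b * G₃ i))
      ≡⟨ cong (S G₁ +_) (cong₂ _+_ (shuffle-*ʳ s k (rising q) G₂) (shuffle-*ʳ s b (rising q) G₃)) ⟩
    S G₁ + (k * S G₂ + b * S G₃)
      ≡⟨ cong (S G₁ +_) (+-identityʳ _) ⟨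
    S G₁ + (k * S G₂ + b * S G₃ + 0) ∎

nCk*k!*[n∸k]!≡n! : ∀ {n k} → k ≤ n → (n C k) * (k ! * (n ∸ k) !) ≡ n !
nCk*k!*[n∸k]!≡n! {n} {k} k≤n = trans (cong (_* (k ! * (n ∸ k) !)) (nCk≡n!/k![n-k]! k≤n))
  (m/n*n≡m {{k !* (n ∸ k) !≢0}} (k![n∸k]!∣n! k≤n))

rising*! : ∀ p r → rising (suc p) r * p ! ≡ (p + r) !
rising*! p zero    = trans (*-identityˡ (p !)) (cong _! (sym (+-identityʳ p)))
rising*! p (suc r) = begin
  suc p * rising (2 + p) r * p !    ≡⟨ swap (suc p) (rising (2 + p) r) (p !) ⟩
  rising (2 + p) r * (suc p * p !)  ≡⟨ rising*! (suc p) r ⟩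
  (suc p + r) !                     ≡⟨ cong _! (+-suc p r) ⟨
  (p + suc r) !                     ∎
  where
  open ≡-Reasoning
  swap : ∀ a b c → a * b * c ≡ b * (a * c)
  swap = solve-∀

-- Multiplied by `p !`, both sides become `(p + r) !`.
rising≡C*! : ∀ p r → rising (suc p) r ≡ ((p + r) C r) * r !
rising≡C*! p r = *-cancelʳ-≡ _ _ (p !) {{p !≢0}} (begin
  rising (suc p) r * p !                       ≡⟨ rising*! p r ⟩
  (p + r) !                                    ≡⟨ nCk*k!*[n∸k]!≡n! (m≤n+m r p) ⟨
  ((p + r) C r) * (r ! * (p + r ∸ r) !)        ≡⟨ cong (λ e → ((p + r) C r) * (r ! * e !)) (m+n∸n≡m p r) ⟩
  ((p + r) C r) * (r ! * p !)                  ≡⟨ *-assoc ((p + r) C r) (r !) (p !) ⟨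
  ((p + r) C r) * r ! * p !                    ∎)
  where open ≡-Reasoning

-- Weights with no insertion left.

δ-lonely≡0⇒≢ : ∀ c → δ c lonely ≡ 0 → c ≢ lonely
δ-lonely≡0⇒≢ lonely () refl

≢⇒δ-lonely≡0 : ∀ c → c ≢ lonely → δ c lonely ≡ 0
≢⇒δ-lonely≡0 pivot  _ = refl
≢⇒δ-lonely≡0 lonely c≢lonely = ⊥-elim (c≢lonely refl)
≢⇒δ-lonely≡0 before _ = refl
≢⇒δ-lonely≡0 after  _ = refl

count-lonely≡0⇒≢ : (χ : Fin n → Colour) → count lonely χ ≡ 0 → ∀ i → χ i ≢ lonely
count-lonely≡0⇒≢ χ eq zero    = δ-lonely≡0⇒≢ (χ zero) (m+n≡0⇒m≡0 _ eq)
count-lonely≡0⇒≢ χ eq (suc i) = count-lonely≡0⇒≢ (χ ∘ suc) (m+n≡0⇒n≡0 (δ (χ zero) lonely) eq) i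

≢⇒count-lonely≡0 : ∀ {n} (χ : Fin n → Colour) → (∀ i → χ i ≢ lonely) → count lonely χ ≡ 0
≢⇒count-lonely≡0 {n} χ χ≢ = trans (sumFin-cong (λ i → ≢⇒δ-lonely≡0 (χ i) (χ≢ i))) (sumFin-0 n)

-- `W 0 k b q` is 1 for `k` equal to 0 and 0 otherwise, so at the end the weight tests for lonely
-- elements. `P` is free, so that the test can be matched with the condition wanted.
weight-0 : (χ : Fin n → Colour) {P : Set} (P? : Dec P) →
  (P → ∀ i → χ i ≢ lonely) → ((∀ i → χ i ≢ lonely) → P) → weight 0 χ ≡ ind P?
weight-0 χ (yes p) to from rewrite ≢⇒count-lonely≡0 χ (to p) = refl
weight-0 χ (no ¬p) to from with count lonely χ in eq
... | zero  = ⊥-elim (¬p (from (count-lonely≡0⇒≢ χ eq)))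
... | suc _ = refl

-- Membership in the list of permutations.

words-unique : ∀ n m → Unique (words n m)
words-unique n zero    = All.[] ∷ []
words-unique n (suc m) =
  Unique.cartesianProductWith⁺ _∷_ ∷-injective (Unique.allFin⁺ n) (words-unique n m)

∈-words : ∀ {m} (w : Vec (Fin n) m) → w ∈ words n m
∈-words []      = here refl
∈-words (x ∷ w) = ∈-cartesianProductWith⁺ _∷_ (∈-allFin x) (∈-words w)

𝒮-unique : ∀ n → Unique (𝒮 n)
𝒮-unique n = Unique.filter⁺ isPermutation? (words-unique n n)

∈-𝒮⁺ : {π : Vec (Fin n) n} → Vec.Unique π → π ∈ 𝒮 n
∈-𝒮⁺ π! = ∈-filter⁺ isPermutation? (∈-words _) π!

∈-𝒮⁻ : {π : Vec (Fin n) n} → π ∈ 𝒮 n → Vec.Unique π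
∈-𝒮⁻ {n} π∈ = proj₂ (∈-filter⁻ isPermutation? {xs = words n n} π∈)

-- Derangements, by insertion into cycles.

module FixedPoints where

  prepend : Vec (Fin n) k → Vec (Fin (suc n)) (suc k)
  prepend σ = zero ∷ Vec.map suc σ

  -- The former preimage of `v` is now sent to the new element, which is itself sent to `v`.
  redirect : Fin n → Fin n → Fin (suc n)
  redirect v z = if does (z ≟ v) then zero else suc z

  -- In cycle notation: place the new smallest element in front of v.
  insert : Fin n → Vec (Fin n) k → Vec (Fin (suc n)) (suc k)
  insert v σ = suc v ∷ Vec.map (redirect v) σ

  redirect-≢ : {v z : Fin n} → z ≢ v → redirect v z ≡ suc z
  redirect-≢ {v = v} {z} z≢v with z ≟ v
  ... | yes z≡v = ⊥-elim (z≢v z≡v)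
  ... | no  _   = refl

  redirect-≡ : (v : Fin n) → redirect v v ≡ zero
  redirect-≡ v with v ≟ v
  ... | yes _   = refl
  ... | no  v≢v = ⊥-elim (v≢v refl)

  redirect-≡suc : {v z x : Fin n} → redirect v z ≡ suc x → z ≡ x × z ≢ v
  redirect-≡suc {v = v} {z} eq with z ≟ v
  redirect-≡suc refl | no z≢v = refl , z≢v

  redirect-injective : {v z x : Fin n} → redirect v z ≡ redirect v x → z ≡ x
  redirect-injective {v = v} {z} {x} eq with z ≟ v | x ≟ v
  ... | yes z≡v | yes x≡v = trans z≡v (sym x≡v)
  redirect-injective refl | no _ | no _ = refl

  unredirect : Fin n → Fin (suc n) → Fin n
  unredirect v zero    = v
  unredirect v (suc z) = z

  -- `suc v` is the one value that `redirect v` misses. In an inserted permutation it is the first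
  -- entry, so distinctness keeps it out of the remaining ones.
  redirect∘unredirect : {v : Fin n} (z : Fin (suc n)) → suc v ≢ z → redirect v (unredirect v z) ≡ z
  redirect∘unredirect {v = v} zero _ = redirect-≡ v
  redirect∘unredirect (suc z) sv≢sz = redirect-≢ (λ z≡v → sv≢sz (cong suc (sym z≡v)))

  map-redirect-unredirect : {v : Fin n} (t : Vec (Fin (suc n)) k) → VecAll.All (suc v ≢_) t →
    Vec.map (redirect v) (Vec.map (unredirect v) t) ≡ t
  map-redirect-unredirect []      VecAll.[] = refl
  map-redirect-unredirect (z ∷ t) (sv≢z VecAll.∷ sv≢t) =
    cong₂ _∷_ (redirect∘unredirect z sv≢z) (map-redirect-unredirect t sv≢t)

  map-suc-surjective : (t : Vec (Fin (suc n)) k) → VecAll.All (zero ≢_) t → ∃[ σ ] t ≡ Vec.map suc σ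
  map-suc-surjective []          _ = [] , refl
  map-suc-surjective (zero ∷ t)  (0≢0 VecAll.∷ _) = ⊥-elim (0≢0 refl)
  map-suc-surjective (suc z ∷ t) (_ VecAll.∷ 0≢t) =
    let (σ , t≡) = map-suc-surjective t 0≢t in z ∷ σ , cong (suc z ∷_) t≡

  Unique-map⁻ : {A B : Set} (f : A → B) {xs : Vec A k} → Vec.Unique (Vec.map f xs) → Vec.Unique xs
  Unique-map⁻ f {[]}     VecAllPairs.[] = VecAllPairs.[]
  Unique-map⁻ f {x ∷ xs} (x≢ VecAllPairs.∷ xs!) =
    VecAll.map (λ fx≢fy x≡y → fx≢fy (cong f x≡y)) (VecAll.map⁻ x≢) VecAllPairs.∷ Unique-map⁻ f xs!

  map-injective : {A B : Set} {f : A → B} → (∀ {x y} → f x ≡ f y → x ≡ y) →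
    {xs ys : Vec A k} → Vec.map f xs ≡ Vec.map f ys → xs ≡ ys
  map-injective inj {[]}     {[]}     _  = refl
  map-injective inj {x ∷ xs} {y ∷ ys} eq =
    cong₂ _∷_ (inj (proj₁ (∷-injective eq))) (map-injective inj (proj₂ (∷-injective eq)))

  prepend-injective : {σ τ : Vec (Fin n) k} → prepend σ ≡ prepend τ → σ ≡ τ
  prepend-injective eq = map-injective Fin.suc-injective (proj₂ (∷-injective eq))

  insert-injective : {v u : Fin n} {σ τ : Vec (Fin n) k} → insert v σ ≡ insert u τ → v ≡ u × σ ≡ τ
  insert-injective eq with refl ← Fin.suc-injective (proj₁ (∷-injective eq)) =
    refl , map-injective redirect-injective (proj₂ (∷-injective eq))

  open module C {n} = Children {Vec (Fin n) n} {Vec (Fin (suc n)) (suc n)} prepend insert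

  children-disjoint : {σ τ : Vec (Fin n) n} → ∀ {z} → z ∈ children σ → z ∈ children τ → σ ≡ τ
  children-disjoint {σ = σ} {τ} z∈ z∈′ with ∈-children⁻ {x = σ} z∈ | ∈-children⁻ {x = τ} z∈′
  ... | inj₁ refl       | inj₁ eq       = prepend-injective eq
  ... | inj₂ (_ , refl) | inj₂ (_ , eq) = proj₂ (insert-injective eq)
  ... | inj₁ refl       | inj₂ (_ , ())
  ... | inj₂ (_ , refl) | inj₁ ()

  children-sound : {σ : Vec (Fin n) n} → ∀ {z} → σ ∈ 𝒮 n → z ∈ children σ → z ∈ 𝒮 (suc n)
  children-sound {σ = σ} σ∈ z∈ with ∈-children⁻ {x = σ} z∈
  ... | inj₁ refl = ∈-𝒮⁺ (VecAll.map⁺ (VecAll.universal (λ _ → 0≢1+n) σ)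
                          VecAllPairs.∷ VecUnique.map⁺ Fin.suc-injective (∈-𝒮⁻ σ∈))
  ... | inj₂ (v , refl) = ∈-𝒮⁺ (VecAll.map⁺ (VecAll.universal (λ z sv≡ →
                              let (z≡v , z≢v) = redirect-≡suc (sym sv≡) in z≢v z≡v) σ)
                          VecAllPairs.∷ VecUnique.map⁺ redirect-injective (∈-𝒮⁻ σ∈))

  children-complete : ∀ {z} → z ∈ 𝒮 (suc n) → ∃[ σ ] σ ∈ 𝒮 n × z ∈ children σ
  children-complete {z = zero ∷ t} z∈ with ∈-𝒮⁻ z∈
  ... | 0≢t VecAllPairs.∷ t! with map-suc-surjective t 0≢t
  ... | σ , refl = σ , ∈-𝒮⁺ (Unique-map⁻ suc t!) , ∈-children-front σ
  children-complete {z = suc v ∷ t} z∈ with ∈-𝒮⁻ z∈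
  ... | sv≢t VecAllPairs.∷ t! = σ , ∈-𝒮⁺ (Unique-map⁻ (redirect v) (subst Vec.Unique (sym fσ≡t) t!))
      , subst (λ e → suc v ∷ e ∈ children σ) fσ≡t (∈-children-insert σ v)
    where
    σ = Vec.map (unredirect v) t
    fσ≡t = map-redirect-unredirect t sv≢t

  sumOver-𝒮-suc : ∀ n (f : Vec (Fin (suc n)) (suc n) → ℕ) →
    sumOver (𝒮 (suc n)) f ≡ sumOver (𝒮 n) (λ σ → f (prepend σ) + sumFin (λ v → f (insert v σ)))
  sumOver-𝒮-suc n = sumOver-children (𝒮-unique n) (𝒮-unique (suc n)) children-disjoint
    (λ _ → children-unique (λ _ ()) (proj₁ ∘ insert-injective)) children-sound children-complete

  fixedColour : Vec (Fin n) n → Fin n → Colour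
  fixedColour π i = if does (lookup π i ≟ i) then lonely else before

  fixed⇒lonely : (π : Vec (Fin n) n) {i : Fin n} → lookup π i ≡ i → fixedColour π i ≡ lonely
  fixed⇒lonely π {i} eq with lookup π i ≟ i
  ... | yes _  = refl
  ... | no neq = ⊥-elim (neq eq)

  moved⇒before : (π : Vec (Fin n) n) {i : Fin n} → lookup π i ≢ i → fixedColour π i ≡ before
  moved⇒before π {i} neq with lookup π i ≟ i
  ... | yes eq = ⊥-elim (neq eq)
  ... | no _   = refl

  fixedColour-cong : ∀ {m} (π : Vec (Fin n) n) (σ : Vec (Fin m) m) {i j} →
    (lookup π i ≡ i → lookup σ j ≡ j) → (lookup σ j ≡ j → lookup π i ≡ i) → fixedColour π i ≡ fixedColour σ j
  fixedColour-cong π σ {i} {j} to from with lookup π i ≟ i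
  ... | yes eq = sym (fixed⇒lonely σ (to eq))
  ... | no neq = sym (moved⇒before σ (neq ∘ from))

  descend-fixedColour : (π : Vec (Fin n) n) (i : Fin n) → descend (fixedColour π i) ≡ before
  descend-fixedColour π i with lookup π i ≟ i
  ... | yes _ = refl
  ... | no  _ = refl

  prepend-fixedColour : (σ : Vec (Fin n) n) (x : Fin n) → fixedColour (prepend σ) (suc x) ≡ fixedColour σ x
  prepend-fixedColour σ x = fixedColour-cong (prepend σ) σ
    (λ eq → Fin.suc-injective (trans (sym (lookup-map x suc σ)) eq))
    (λ eq → trans (lookup-map x suc σ) (cong suc eq))

  -- The new element goes to `v`, and `v` cannot be fixed since the value `v` was redirected. Any
  -- other fixed `x` has a value different from `v` and stays fixed, and no moved element becomes
  -- fixed.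
  insert-fixedColour : (σ : Vec (Fin n) n) (v : Fin n) → Inserted (fixedColour σ) v (fixedColour (insert v σ))
  insert-fixedColour σ v = record
    { new   = sym (descend-fixedColour σ v)
    ; self  = trans (moved⇒before (insert v σ) (λ eq →
                let (σv≡v , σv≢v) = redirect-≡suc (trans (sym (lookup-map v (redirect v) σ)) eq) in σv≢v σv≡v))
              (sym (descend-fixedColour σ v))
    ; other = λ x x≢v → fixedColour-cong (insert v σ) σ
        (λ eq → proj₁ (redirect-≡suc (trans (sym (lookup-map x (redirect v) σ)) eq)))
        (λ eq → trans (lookup-map x (redirect v) σ) (trans (cong (redirect v) eq) (redirect-≢ x≢v)))
    }

  fixedColour≢pivot : (σ : Vec (Fin n) n) (x : Fin n) → fixedColour σ x ≢ pivot
  fixedColour≢pivot σ x eq with lookup σ x ≟ x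
  fixedColour≢pivot σ x () | yes _
  fixedColour≢pivot σ x () | no _

  -- Removing the smallest element and planning one more insertion keeps `n + t`. At size 0 only the
  -- empty permutation is left, of weight `W t 0 0 0`.
  sumOver-weight : ∀ n t → sumOver (𝒮 n) (weight t ∘ fixedColour) ≡ W (n + t) 0 0 0
  sumOver-weight zero    t = +-identityʳ _
  sumOver-weight (suc n) t = begin
    sumOver (𝒮 (suc n)) (weight t ∘ fixedColour)
      ≡⟨ sumOver-𝒮-suc n (weight t ∘ fixedColour) ⟩
    sumOver (𝒮 n) (λ σ → weight t (fixedColour (prepend σ)) + sumFin (λ v → weight t (fixedColour (insert v σ))))
      ≡⟨ sumOver-cong (𝒮 n) (λ {σ} _ → weight-suc t (fixedColour σ) (fixedColour (prepend σ)) _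
           refl (prepend-fixedColour σ)
           (λ y eq → ⊥-elim (fixedColour≢pivot σ y eq)) (λ y _ → _ , insert-fixedColour σ y , refl)) ⟨
    sumOver (𝒮 n) (weight (suc t) ∘ fixedColour)
      ≡⟨ sumOver-weight n (suc t) ⟩
    W (n + suc t) 0 0 0
      ≡⟨ cong (λ e → W e 0 0 0) (+-suc n t) ⟩
    W (suc n + t) 0 0 0 ∎
    where open ≡-Reasoning

  d≡W : ∀ n → d n ≡ W n 0 0 0
  d≡W n = begin
    d n                                       ≡⟨ length-filter≡sumOver isDerangement? (𝒮 n) ⟩
    sumOver (𝒮 n) (ind ∘ isDerangement?)      ≡⟨ sumOver-cong (𝒮 n) (λ {π} _ → weight-0 (fixedColour π) (isDerangement? π)
                                                   (λ der i eq → der (i , lonely⇒fixed π i eq))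
                                                   (λ none (i , eq) → none i (fixed⇒lonely π eq))) ⟨
    sumOver (𝒮 n) (weight 0 ∘ fixedColour)    ≡⟨ sumOver-weight n 0 ⟩
    W (n + 0) 0 0 0                           ≡⟨ cong (λ e → W e 0 0 0) (+-identityʳ n) ⟩
    W n 0 0 0                                 ∎
    where
    open ≡-Reasoning
    lonely⇒fixed : (π : Vec (Fin n) n) (i : Fin n) → fixedColour π i ≡ lonely → lookup π i ≡ i
    lonely⇒fixed π i eq with lookup π i ≟ i
    ... | yes fix = fix
    lonely⇒fixed π i () | no _

-- Permutations as lists, and insertion into words.

toList-unique⁺ : {A : Set} {v : Vec A k} → Vec.Unique v → Unique (toList v)
toList-unique⁺ VecAllPairs.[]         = []
toList-unique⁺ (x≢ VecAllPairs.∷ v!) = VecAll.toList⁺ x≢ ∷ toList-unique⁺ v!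

toList-unique⁻ : {A : Set} {v : Vec A k} → Unique (toList v) → Vec.Unique v
toList-unique⁻ {v = []}    []        = VecAllPairs.[]
toList-unique⁻ {v = _ ∷ _} (x≢ ∷ v!) = VecAll.toList⁻ x≢ VecAllPairs.∷ toList-unique⁻ v!

toVec : (w : List (Fin n)) → length w ≡ k → ∃[ v ] toList {n = k} v ≡ w
toVec w eq = Vec.cast eq (fromList w) , trans (Vec.toList-cast eq (fromList w)) (Vec.toList∘fromList w)

-- Lists are used because `insertAfter y` lengthens a word only if `y` occurs in it, and because
-- `cycleForm` reads a list.
𝒮ʷ : ∀ n → List (List (Fin n))
𝒮ʷ n = map toList (𝒮 n)

toList-injective : {A : Set} {u v : Vec A k} → toList u ≡ toList v → u ≡ v
toList-injective {u = u} {v} eq = trans (sym (Vec.cast-is-id refl u)) (Vec.toList-injective refl u v eq)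

𝒮ʷ-unique : ∀ n → Unique (𝒮ʷ n)
𝒮ʷ-unique n = Unique.map⁺ toList-injective (𝒮-unique n)

∈-𝒮ʷ⁻ : {w : List (Fin n)} → w ∈ 𝒮ʷ n → Unique w × length w ≡ n
∈-𝒮ʷ⁻ w∈ with ∈-map⁻ toList w∈
... | π , π∈ , refl = toList-unique⁺ (∈-𝒮⁻ π∈) , Vec.length-toList π

∈-𝒮ʷ⁺ : {w : List (Fin n)} → Unique w → length w ≡ n → w ∈ 𝒮ʷ n
∈-𝒮ʷ⁺ {w = w} w! eq with toVec w eq
... | v , refl = ∈-map⁺ toList (∈-𝒮⁺ (toList-unique⁻ w!))

-- A missing `x`, put in front of the word, would give `n + 1` distinct elements of `Fin n`.
unique⇒complete : {w : List (Fin n)} → Unique w → length w ≡ n → ∀ x → x ∈ w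
unique⇒complete {n} {w} w! eq x with Any.any? (x ≟_) w
... | yes x∈ = x∈
... | no x∉  with toVec w eq
... | v , refl = let (i , j , i<j , eq′) = pigeonhole (n<1+n n) (lookup (x ∷ v)) in
  ⊥-elim (Fin.<⇒≢ i<j (VecUnique.lookup-injective
    (VecAll.toList⁻ (All.¬Any⇒All¬ w x∉) VecAllPairs.∷ toList-unique⁻ w!) i j eq′))

prepend : List (Fin n) → List (Fin (suc n))
prepend w = zero ∷ map suc w

gap : Bool → List (Fin (suc n)) → List (Fin (suc n))
gap b w = if b then zero ∷ w else w

insertAfter : Fin n → List (Fin n) → List (Fin (suc n))
insertAfter y []      = []
insertAfter y (z ∷ w) = suc z ∷ gap (does (z ≟ y)) (insertAfter y w)

-- Recovers the parent from either kind of child. Children of different words are therefore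
-- different, and every word has a candidate for its parent.
lower : List (Fin (suc n)) → List (Fin n)
lower []          = []
lower (zero  ∷ w) = lower w
lower (suc z ∷ w) = z ∷ lower w

lower-map-suc : (w : List (Fin n)) → lower (map suc w) ≡ w
lower-map-suc []      = refl
lower-map-suc (z ∷ w) = cong (z ∷_) (lower-map-suc w)

lower-insertAfter : ∀ y (w : List (Fin n)) → lower (insertAfter y w) ≡ w
lower-insertAfter y []      = refl
lower-insertAfter y (z ∷ w) with does (z ≟ y)
... | true  = cong (z ∷_) (lower-insertAfter y w)
... | false = cong (z ∷_) (lower-insertAfter y w)

∈-lower : {x : Fin n} (w : List (Fin (suc n))) → x ∈ lower w → suc x ∈ w
∈-lower (zero  ∷ w) x∈         = there (∈-lower w x∈)
∈-lower (suc z ∷ w) (here eq)  = here (cong suc eq)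
∈-lower (suc z ∷ w) (there x∈) = there (∈-lower w x∈)

lower-unique : {w : List (Fin (suc n))} → Unique w → Unique (lower w)
lower-unique {w = []}        []        = []
lower-unique {w = zero ∷ w}  (_ ∷ w!)  = lower-unique w!
lower-unique {w = suc z ∷ w} (z∉ ∷ w!) =
  All.tabulate (λ x∈ z≡x → All.lookup z∉ (∈-lower w x∈) (cong suc z≡x)) ∷ lower-unique w!

map-suc-lower : (w : List (Fin (suc n))) → All (zero ≢_) w → w ≡ map suc (lower w)
map-suc-lower []          _ = refl
map-suc-lower (zero  ∷ w) (0≢0 All.∷ _) = ⊥-elim (0≢0 refl)
map-suc-lower (suc z ∷ w) (_ All.∷ 0≢w) = cong (suc z ∷_) (map-suc-lower w 0≢w)

insertAfter-∉ : ∀ {y} {w : List (Fin n)} → All (y ≢_) w → insertAfter y w ≡ map suc w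
insertAfter-∉ All.[] = refl
insertAfter-∉ {y = y} {z ∷ w} (y≢z All.∷ y∉w) with z ≟ y
... | yes z≡y = ⊥-elim (y≢z (sym z≡y))
... | no  _   = cong (suc z ∷_) (insertAfter-∉ y∉w)

insertAfter-here : ∀ y {w : List (Fin n)} → All (y ≢_) w → insertAfter y (y ∷ w) ≡ suc y ∷ prepend w
insertAfter-here y y∉w with y ≟ y
... | yes _  = cong (λ e → suc y ∷ zero ∷ e) (insertAfter-∉ y∉w)
... | no y≢y = ⊥-elim (y≢y refl)

insertAfter-there : ∀ {y z} (w : List (Fin n)) → z ≢ y → insertAfter y (z ∷ w) ≡ suc z ∷ insertAfter y w
insertAfter-there {y = y} {z} w z≢y with z ≟ y
... | yes z≡y = ⊥-elim (z≢y z≡y)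
... | no  _   = refl

0∉map-suc : (w : List (Fin n)) → All (zero ≢_) (map suc w)
0∉map-suc w = All.map⁺ (All.universal (λ _ → 0≢1+n) w)

suc∉map-suc : ∀ {y} {w : List (Fin n)} → All (y ≢_) w → All (suc y ≢_) (map suc w)
suc∉map-suc y∉w = All.map⁺ (All.map (_∘ Fin.suc-injective) y∉w)

suc∉insertAfter : ∀ {z} y {w : List (Fin n)} → All (z ≢_) w → All (suc z ≢_) (insertAfter y w)
suc∉insertAfter y All.[] = All.[]
suc∉insertAfter y {x ∷ w} (z≢x All.∷ z∉w) with does (x ≟ y)
... | true  = (z≢x ∘ Fin.suc-injective) All.∷ (λ ()) All.∷ suc∉insertAfter y z∉w
... | false = (z≢x ∘ Fin.suc-injective) All.∷ suc∉insertAfter y z∉w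

prepend-unique : {w : List (Fin n)} → Unique w → Unique (prepend w)
prepend-unique {w = w} w! = 0∉map-suc w ∷ Unique.map⁺ Fin.suc-injective w!

insertAfter-perm : ∀ {y} {w : List (Fin n)} → Unique w → y ∈ w →
  Unique (insertAfter y w) × length (insertAfter y w) ≡ suc (length w)
insertAfter-perm {y = y} {y ∷ w} (y∉w ∷ w!) (here refl) =
  subst Unique (sym eq) (((λ ()) All.∷ suc∉map-suc y∉w) ∷ prepend-unique w!) ,
  trans (cong length eq) (cong (2 +_) (length-map suc w))
  where eq = insertAfter-here y y∉w
insertAfter-perm {y = y} {z ∷ w} (z∉w ∷ w!) (there y∈w) =
  let (ins! , len) = insertAfter-perm w! y∈w in
  subst Unique (sym eq) (suc∉insertAfter y z∉w ∷ ins!) , trans (cong length eq) (cong suc len)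
  where eq = insertAfter-there w (All.lookup z∉w y∈w)

prepend≢insertAfter : ∀ (w : List (Fin n)) y → prepend w ≢ insertAfter y w
prepend≢insertAfter (_ ∷ _) y ()

insertAfter-injective : ∀ {y z} {w : List (Fin n)} → Unique w → y ∈ w → z ∈ w →
  insertAfter y w ≡ insertAfter z w → y ≡ z
insertAfter-injective w! (here refl) (here refl) eq = refl
insertAfter-injective {y = y} {z} {y ∷ w} (y∉w ∷ w!) (here refl) (there z∈w) eq =
  ⊥-elim (prepend≢insertAfter w z (proj₂ (List.∷-injective
    (trans (sym (insertAfter-here y y∉w)) (trans eq (insertAfter-there w (All.lookup y∉w z∈w)))))))
insertAfter-injective {y = y} {z} {z ∷ w} (z∉w ∷ w!) (there y∈w) (here refl) eq =
  ⊥-elim (prepend≢insertAfter w y (proj₂ (List.∷-injective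
    (trans (sym (insertAfter-here z z∉w)) (trans (sym eq) (insertAfter-there w (All.lookup z∉w y∈w)))))))
insertAfter-injective {y = y} {z} {x ∷ w} (x∉w ∷ w!) (there y∈w) (there z∈w) eq =
  insertAfter-injective w! y∈w z∈w (proj₂ (List.∷-injective
    (trans (sym (insertAfter-there w (All.lookup x∉w y∈w))) (trans eq (insertAfter-there w (All.lookup x∉w z∈w))))))

uninsert : (w : List (Fin (suc n))) → Unique w → zero ∈ w →
  w ≡ prepend (lower w) ⊎ ∃[ y ] y ∈ lower w × w ≡ insertAfter y (lower w)
uninsert (zero  ∷ w) (0∉w ∷ _)  _ = inj₁ (cong (zero ∷_) (map-suc-lower w 0∉w))
uninsert (suc z ∷ w) (sz∉w ∷ w!) (there 0∈w) with uninsert w w! 0∈w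
... | inj₁ w≡ = inj₂ (z , here refl , trans (cong (suc z ∷_) w≡)
  (sym (insertAfter-here z (All.tabulate (λ x∈ z≡x → All.lookup sz∉w (∈-lower w x∈) (cong suc z≡x))))))
... | inj₂ (y , y∈ , w≡) = inj₂ (y , there y∈ , trans (cong (suc z ∷_) w≡)
  (sym (insertAfter-there (lower w) (λ z≡y → All.lookup sz∉w (∈-lower w y∈) (cong suc z≡y)))))

open module WordChildren {n} = Children {List (Fin n)} {List (Fin (suc n))} prepend insertAfter

sumOver-𝒮ʷ-suc : ∀ n (f : List (Fin (suc n)) → ℕ) →
  sumOver (𝒮ʷ (suc n)) f ≡ sumOver (𝒮ʷ n) (λ w → f (prepend w) + sumFin (λ y → f (insertAfter y w)))
sumOver-𝒮ʷ-suc n = sumOver-children (𝒮ʷ-unique n) (𝒮ʷ-unique (suc n)) disjoint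
  (λ {w} w∈ → let (w! , len) = ∈-𝒮ʷ⁻ w∈ in
    children-unique {x = w} (prepend≢insertAfter w)
      (insertAfter-injective w! (unique⇒complete w! len _) (unique⇒complete w! len _)))
  sound complete
  where
  lower-child : ∀ {w : List (Fin n)} {z} → z ∈ children w → lower z ≡ w
  lower-child {w} z∈ with ∈-children⁻ {x = w} z∈
  ... | inj₁ refl       = lower-map-suc w
  ... | inj₂ (y , refl) = lower-insertAfter y w
  disjoint : ∀ {v w : List (Fin n)} {z} → z ∈ children v → z ∈ children w → v ≡ w
  disjoint z∈v z∈w = trans (sym (lower-child z∈v)) (lower-child z∈w)
  sound : ∀ {w z} → w ∈ 𝒮ʷ n → z ∈ children w → z ∈ 𝒮ʷ (suc n)
  sound {w} w∈ z∈ with ∈-𝒮ʷ⁻ w∈ | ∈-children⁻ {x = w} z∈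
  ... | w! , len | inj₁ refl = ∈-𝒮ʷ⁺ (prepend-unique w!) (cong suc (trans (length-map suc w) len))
  ... | w! , len | inj₂ (y , refl) = let (ins! , len′) = insertAfter-perm w! (unique⇒complete w! len y) in
    ∈-𝒮ʷ⁺ ins! (trans len′ (cong suc len))
  complete : ∀ {z} → z ∈ 𝒮ʷ (suc n) → ∃[ w ] w ∈ 𝒮ʷ n × z ∈ children w
  complete {z} z∈ with ∈-𝒮ʷ⁻ z∈
  ... | z! , len with uninsert z z! (unique⇒complete z! len zero)
  ... | inj₁ z≡ = lower z , ∈-𝒮ʷ⁺ (lower-unique z!)
          (ℕ.suc-injective (trans (trans (cong suc (sym (length-map suc (lower z)))) (cong length (sym z≡))) len))
        , subst (_∈ children (lower z)) (sym z≡) (∈-children-front (lower z))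
  ... | inj₂ (y , y∈ , z≡) = lower z , ∈-𝒮ʷ⁺ (lower-unique z!)
          (ℕ.suc-injective (trans (trans (sym (proj₂ (insertAfter-perm (lower-unique z!) y∈))) (cong length (sym z≡))) len))
        , subst (_∈ children (lower z)) (sym z≡) (∈-children-insert (lower z) y)

-- Precedence and loneliness in a word.

precedes : (y x : Fin n) → List (Fin n) → Bool
precedes y x []      = false
-- `x` is tested first, so no entry precedes itself. If `y` occurs and `x` does not, the value is
-- `true`; later lemmas therefore ask for `x` to be in the word.
precedes y x (z ∷ w) =
  if does (z ≟ x) then false else (if does (z ≟ y) then true else precedes y x w)

isSingleton : Fin n → List⁺ (Fin n) → Bool
isSingleton x (a ∷ [])    = does (a ≟ x)
isSingleton x (_ ∷ _ ∷ _) = false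

isLonely : Fin n → List (Fin n) → Bool
isLonely x w = any (isSingleton x) (cycleForm w)

-- How the insertions act on words

if-cong : ∀ {A : Set} b {x y z : A} → y ≡ z → (if b then x else y) ≡ (if b then x else z)
if-cong b = cong (if b then _ else_)

precedes-map-suc : ∀ (y x : Fin n) w → precedes (suc y) (suc x) (map suc w) ≡ precedes y x w
precedes-map-suc y x []      = refl
precedes-map-suc y x (z ∷ w) = if-cong (does (z ≟ x)) (if-cong (does (z ≟ y)) (precedes-map-suc y x w))

precedes-gap : ∀ b (y x : Fin n) w → precedes (suc y) (suc x) (gap b w) ≡ precedes (suc y) (suc x) w
precedes-gap true  y x w = refl
precedes-gap false y x w = refl

precedes-insertAfter : ∀ v (y x : Fin n) w → precedes (suc y) (suc x) (insertAfter v w) ≡ precedes y x w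
precedes-insertAfter v y x []      = refl
precedes-insertAfter v y x (z ∷ w) = if-cong (does (z ≟ x)) (if-cong (does (z ≟ y))
  (trans (precedes-gap (does (z ≟ v)) y x _) (precedes-insertAfter v y x w)))

precedes-0-insertAfter : ∀ {y x : Fin n} w → y ≢ x → precedes zero (suc x) (insertAfter y w) ≡ precedes y x w
precedes-0-insertAfter []      y≢x = refl
precedes-0-insertAfter {y = y} {x} (z ∷ w) y≢x with z ≟ y | z ≟ x
... | _        | yes _ = refl
... | yes refl | no _  = refl
... | no _     | no _  = precedes-0-insertAfter w y≢x

precedes-insertAfter-0 : ∀ {y : Fin n} {w} → y ∈ w → precedes (suc y) zero (insertAfter y w) ≡ true
precedes-insertAfter-0 {y = y} {z ∷ w} y∈ with z ≟ y
precedes-insertAfter-0 y∈          | yes _  = refl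
precedes-insertAfter-0 (here refl) | no y≢y = ⊥-elim (y≢y refl)
precedes-insertAfter-0 (there y∈)  | no _   = precedes-insertAfter-0 y∈

mapCycle : List⁺ (Fin n) → List⁺ (Fin (suc n))
mapCycle (a ∷ c) = suc a ∷ map suc c

insertCycle : Fin n → List⁺ (Fin n) → List⁺ (Fin (suc n))
insertCycle y (a ∷ c) = suc a ∷ gap (does (a ≟ y)) (insertAfter y c)

breakAtMaxima-map-suc : ∀ (a : Fin n) w → let (c , cs) = breakAtMaxima a w in
  breakAtMaxima (suc a) (map suc w) ≡ (map suc c , map mapCycle cs)
breakAtMaxima-map-suc a [] = refl
breakAtMaxima-map-suc a (b ∷ w) with suc a <? suc b | a <? b
... | yes _ | yes _ rewrite breakAtMaxima-map-suc b w = refl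
... | no _  | no _  rewrite breakAtMaxima-map-suc a w = refl
... | yes (s≤s p) | no ¬p = ⊥-elim (¬p p)
... | no ¬p | yes p = ⊥-elim (¬p (s≤s p))

-- A zero never exceeds the running maximum, so it stays in the open cycle.
breakAtMaxima-gap : ∀ β (a : Fin n) w → let (c , cs) = breakAtMaxima (suc a) w in
  breakAtMaxima (suc a) (gap β w) ≡ (gap β c , cs)
breakAtMaxima-gap false a w = refl
breakAtMaxima-gap {n} true a w with suc a <? zero {n}
... | no _ = refl

-- The inserted zero is neither a left-to-right maximum nor a change to the running maximum, so the
-- word breaks at the same places as before.
breakAtMaxima-insertAfter : ∀ y (a : Fin n) w → let (c , cs) = breakAtMaxima a w in
  breakAtMaxima (suc a) (insertAfter y w) ≡ (insertAfter y c , map (insertCycle y) cs)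
breakAtMaxima-insertAfter y a [] = refl
breakAtMaxima-insertAfter y a (b ∷ w) with suc a <? suc b | a <? b
... | yes _ | yes _ rewrite breakAtMaxima-gap (does (b ≟ y)) b (insertAfter y w)
                          | breakAtMaxima-insertAfter y b w = refl
... | no _  | no _  rewrite breakAtMaxima-gap (does (b ≟ y)) a (insertAfter y w)
                          | breakAtMaxima-insertAfter y a w = refl
... | yes (s≤s p) | no ¬p = ⊥-elim (¬p p)
... | no ¬p | yes p = ⊥-elim (¬p (s≤s p))

-- The old first entry exceeds the leading zero and closes its cycle at once; from there on the
-- running maximum is the old one.
cycleForm-prepend : (w : List (Fin n)) → cycleForm (prepend w) ≡ (zero ∷ []) ∷ map mapCycle (cycleForm w)
cycleForm-prepend []      = refl
cycleForm-prepend {n} (a ∷ w) with zero {n} <? suc a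
... | yes _ rewrite breakAtMaxima-map-suc a w = refl
... | no ¬p = ⊥-elim (¬p z<s)

cycleForm-insertAfter : ∀ y (w : List (Fin n)) → cycleForm (insertAfter y w) ≡ map (insertCycle y) (cycleForm w)
cycleForm-insertAfter y [] = refl
cycleForm-insertAfter y (a ∷ w)
  rewrite breakAtMaxima-gap (does (a ≟ y)) a (insertAfter y w) | breakAtMaxima-insertAfter y a w = refl

any-map : ∀ {A B : Set} (p : B → Bool) (q : A → Bool) (f : A → B) →
  (∀ a → p (f a) ≡ q a) → ∀ xs → any p (map f xs) ≡ any q xs
any-map p q f eq []       = refl
any-map p q f eq (x ∷ xs) = cong₂ _∨_ (eq x) (any-map p q f eq xs)

any-false : ∀ {A : Set} (xs : List A) → any (λ _ → false) xs ≡ false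
any-false []       = refl
any-false (_ ∷ xs) = any-false xs

isLonely-0-prepend : (w : List (Fin n)) → isLonely zero (prepend w) ≡ true
isLonely-0-prepend w = cong (any (isSingleton zero)) (cycleForm-prepend w)

isLonely-prepend : ∀ x (w : List (Fin n)) → isLonely (suc x) (prepend w) ≡ isLonely x w
isLonely-prepend x w = trans (cong (any (isSingleton (suc x))) (cycleForm-prepend w))
  (any-map _ _ mapCycle same (cycleForm w))
  where
  same : ∀ c → isSingleton (suc x) (mapCycle c) ≡ isSingleton x c
  same (a ∷ [])    = refl
  same (_ ∷ _ ∷ _) = refl

-- Every cycle still begins with an old entry, so none consists of the zero alone.
isLonely-0-insertAfter : ∀ y (w : List (Fin n)) → isLonely zero (insertAfter y w) ≡ false
isLonely-0-insertAfter y w = trans (cong (any (isSingleton zero)) (cycleForm-insertAfter y w))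
  (trans (any-map _ _ (insertCycle y) none (cycleForm w)) (any-false (cycleForm w)))
  where
  none : ∀ c → isSingleton zero (insertCycle y c) ≡ false
  none (a ∷ c) with gap (does (a ≟ y)) (insertAfter y c)
  ... | []    = refl
  ... | _ ∷ _ = refl

-- A cycle that begins with `suc y` now has the zero as its second entry.
isLonely-insertAfter-self : ∀ y (w : List (Fin n)) → isLonely (suc y) (insertAfter y w) ≡ false
isLonely-insertAfter-self y w = trans (cong (any (isSingleton (suc y))) (cycleForm-insertAfter y w))
  (trans (any-map _ _ (insertCycle y) none (cycleForm w)) (any-false (cycleForm w)))
  where
  none : ∀ c → isSingleton (suc y) (insertCycle y c) ≡ false
  none (a ∷ c) with a ≟ y
  none (a ∷ c)     | yes _  = refl
  none (a ∷ [])    | no a≢y with a ≟ y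
  ... | yes a≡y = ⊥-elim (a≢y a≡y)
  ... | no  _   = refl
  none (a ∷ _ ∷ _) | no _   = refl

isLonely-insertAfter : ∀ {y x} (w : List (Fin n)) → x ≢ y → isLonely (suc x) (insertAfter y w) ≡ isLonely x w
isLonely-insertAfter {y = y} {x} w x≢y = trans (cong (any (isSingleton (suc x))) (cycleForm-insertAfter y w))
  (any-map _ _ (insertCycle y) same (cycleForm w))
  where
  same : ∀ c → isSingleton (suc x) (insertCycle y c) ≡ isSingleton x c
  same (a ∷ c) with a ≟ y
  same (a ∷ [])    | no _ = refl
  same (a ∷ _ ∷ _) | no _ = refl
  same (a ∷ _ ∷ _) | yes refl = refl
  same (a ∷ [])    | yes refl with a ≟ x
  ... | yes refl = ⊥-elim (x≢y refl)
  ... | no _     = refl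

-- Words with no lonely element

lonelyColour : List (Fin n) → Fin n → Colour
lonelyColour w x = if isLonely x w then lonely else before

lonelyColour-inserted : ∀ (w : List (Fin n)) y → Inserted (lonelyColour w) y (lonelyColour (insertAfter y w))
lonelyColour-inserted w y = record
  { new   = trans (cong (if_then lonely else before) (isLonely-0-insertAfter y w)) (descended (isLonely y w))
  ; self  = trans (cong (if_then lonely else before) (isLonely-insertAfter-self y w)) (descended (isLonely y w))
  ; other = λ x x≢y → cong (if_then lonely else before) (isLonely-insertAfter w x≢y)
  }
  where
  descended : ∀ b → before ≡ descend (if b then lonely else before)
  descended true  = refl
  descended false = refl

lonelyColour≢pivot : ∀ (w : List (Fin n)) x → lonelyColour w x ≢ pivot
lonelyColour≢pivot w x eq with isLonely x w
lonelyColour≢pivot w x () | true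
lonelyColour≢pivot w x () | false

-- Loneliness in words obeys the colour rule of fixed points in permutations, so the argument for
-- derangements applies and gives the same value of `W`.
sumOver-lonelyColour : ∀ n t → sumOver (𝒮ʷ n) (weight t ∘ lonelyColour) ≡ W (n + t) 0 0 0
sumOver-lonelyColour zero    t = +-identityʳ _
sumOver-lonelyColour (suc n) t = begin
  sumOver (𝒮ʷ (suc n)) (weight t ∘ lonelyColour)
    ≡⟨ sumOver-𝒮ʷ-suc n (weight t ∘ lonelyColour) ⟩
  sumOver (𝒮ʷ n) (λ w → weight t (lonelyColour (prepend w)) + sumFin (λ y → weight t (lonelyColour (insertAfter y w))))
    ≡⟨ sumOver-cong (𝒮ʷ n) (λ {w} _ → weight-suc t (lonelyColour w) (lonelyColour (prepend w)) _
         (cong (if_then lonely else before) (isLonely-0-prepend w))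
         (λ x → cong (if_then lonely else before) (isLonely-prepend x w))
         (λ y eq → ⊥-elim (lonelyColour≢pivot w y eq)) (λ y _ → _ , lonelyColour-inserted w y , refl)) ⟨
  sumOver (𝒮ʷ n) (weight (suc t) ∘ lonelyColour)
    ≡⟨ sumOver-lonelyColour n (suc t) ⟩
  W (n + suc t) 0 0 0
    ≡⟨ cong (λ e → W e 0 0 0) (+-suc n t) ⟩
  W (suc n + t) 0 0 0 ∎
  where open ≡-Reasoning

-- Words with a lonely pivot above which the entries increase

IncreasingWord : List (Fin n) → Set
IncreasingWord w = ∀ x y → x <ᶠ y → precedes y x w ≡ false

increasing? : (w : List (Fin n)) → Dec (IncreasingWord w)
increasing? w = all? λ x → all? λ y → (x <? y) →-dec (precedes y x w Bool.≟ false)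

IncreasingAbove : Fin n → List (Fin n) → Set
IncreasingAbove m w = ∀ x y → m <ᶠ x → x <ᶠ y → precedes y x w ≡ false

increasingAbove? : (m : Fin n) (w : List (Fin n)) → Dec (IncreasingAbove m w)
increasingAbove? m w = all? λ x → all? λ y →
  (m <? x) →-dec ((x <? y) →-dec (precedes y x w Bool.≟ false))

-- Only what survives every later insertion not directly after `m` is demanded here. Smaller lonely
-- entries are tolerated and left to the weight.
Pivot : Fin n → List (Fin n) → Set
Pivot m w = isLonely m w ≡ true × IncreasingAbove m w

pivot? : (m : Fin n) (w : List (Fin n)) → Dec (Pivot m w)
pivot? m w = (isLonely m w Bool.≟ true) ×-dec increasingAbove? m w

-- Loneliness is recorded in front of the pivot only. Behind a lonely pivot, a smaller entry is no
-- left-to-right maximum and a larger one cannot prevent the pivot from being the least lonely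
-- entry.
colour : (isPivot precedesPivot isLonely : Bool) → Colour
colour p q l = if p then pivot else (if q then (if l then lonely else before) else after)

pivotColour : Fin n → List (Fin n) → Fin n → Colour
pivotColour m w x = colour (does (x ≟ m)) (precedes x m w) (isLonely x w)

pivotColour-inserted : ∀ {m} (w : List (Fin n)) {y} → y ≢ m →
  Inserted (pivotColour m w) y (pivotColour (suc m) (insertAfter y w))
pivotColour-inserted {m = m} w {y} y≢m = record
  { new   = trans (cong₂ (colour false) (precedes-0-insertAfter w y≢m) (isLonely-0-insertAfter y w)) descended
  ; self  = trans (cong₂ (colour (does (y ≟ m))) (precedes-insertAfter y y m w) (isLonely-insertAfter-self y w)) kept
  ; other = λ x x≢y → cong₂ (colour (does (x ≟ m))) (precedes-insertAfter y x m w) (isLonely-insertAfter w x≢y)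
  }
  where
  descended : colour false (precedes y m w) false ≡ descend (pivotColour m w y)
  descended with y ≟ m | precedes y m w | isLonely y w
  ... | yes y≡m | _     | _     = ⊥-elim (y≢m y≡m)
  ... | no _    | true  | true  = refl
  ... | no _    | true  | false = refl
  ... | no _    | false | _     = refl
  kept : colour (does (y ≟ m)) (precedes y m w) false ≡ descend (pivotColour m w y)
  kept with does (y ≟ m) | precedes y m w | isLonely y w
  ... | true  | _     | _     = refl
  ... | false | true  | true  = refl
  ... | false | true  | false = refl
  ... | false | false | _     = refl

pivotColour-prepend : ∀ m (w : List (Fin n)) x → pivotColour (suc m) (prepend w) (suc x) ≡ pivotColour m w x
pivotColour-prepend m w x = cong₂ (colour (does (x ≟ m))) (precedes-map-suc x m w) (isLonely-prepend x w)

pivotColour≡pivot : ∀ m (w : List (Fin n)) x → pivotColour m w x ≡ pivot → x ≡ m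
pivotColour≡pivot m w x eq with x ≟ m | precedes x m w | isLonely x w
... | yes x≡m | _ | _ = x≡m
pivotColour≡pivot m w x () | no _ | true  | true
pivotColour≡pivot m w x () | no _ | true  | false
pivotColour≡pivot m w x () | no _ | false | _

-- The new entry `zero` lies below `suc m`, so the entries above the pivot are exactly the shifted
-- old ones.
increasingAbove-suc : ∀ {m : Fin n} {w w′} → (∀ x y → precedes (suc y) (suc x) w′ ≡ precedes y x w) →
  (IncreasingAbove m w → IncreasingAbove (suc m) w′) × (IncreasingAbove (suc m) w′ → IncreasingAbove m w)
increasingAbove-suc {m = m} {w} {w′} eq =
  to , λ inc x y m<x x<y → trans (sym (eq x y)) (inc (suc x) (suc y) (s≤s m<x) (s≤s x<y))
  where
  to : IncreasingAbove m w → IncreasingAbove (suc m) w′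
  to inc zero    y       ()        _
  to inc (suc x) (suc y) (s≤s m<x) (s≤s x<y) = trans (eq x y) (inc x y m<x x<y)

pivot-prepend : ∀ m (w : List (Fin n)) → ind (pivot? (suc m) (prepend w)) ≡ ind (pivot? m w)
pivot-prepend m w = ind-cong (pivot? (suc m) (prepend w)) (pivot? m w)
  (λ (l , inc) → trans (sym (isLonely-prepend m w)) l , proj₂ above inc)
  (λ (l , inc) → trans (isLonely-prepend m w) l , proj₁ above inc)
  where above = increasingAbove-suc {m = m} {w} {prepend w} (λ x y → precedes-map-suc y x w)

pivot-insertAfter : ∀ {m y} (w : List (Fin n)) → y ≢ m → ind (pivot? (suc m) (insertAfter y w)) ≡ ind (pivot? m w)
pivot-insertAfter {m = m} {y} w y≢m = ind-cong (pivot? (suc m) (insertAfter y w)) (pivot? m w)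
  (λ (l , inc) → trans (sym (isLonely-insertAfter w (y≢m ∘ sym))) l , proj₂ above inc)
  (λ (l , inc) → trans (isLonely-insertAfter w (y≢m ∘ sym)) l , proj₁ above inc)
  where above = increasingAbove-suc {m = m} {w} {insertAfter y w} (λ x z → precedes-insertAfter y z x w)

pivot-insertAfter-self : ∀ m (w : List (Fin n)) → ind (pivot? (suc m) (insertAfter m w)) ≡ 0
pivot-insertAfter-self m w = ind-no (pivot? (suc m) (insertAfter m w))
  (λ (l , _) → case trans (sym l) (isLonely-insertAfter-self m w) of λ ())

pivotWeight : ℕ → Fin n → List (Fin n) → ℕ
pivotWeight t m w = ind (pivot? m w) * weight t (pivotColour m w)

-- `Pivot` passes unchanged to every child except the one with the new entry directly after `m`,
-- where it fails. So `weight-suc` applies if `m` is a pivot of `w`, and all terms vanish otherwise.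
pivotWeight-suc : ∀ t m (w : List (Fin n)) → pivotWeight (suc t) m w ≡
  pivotWeight t (suc m) (prepend w) + sumFin (λ y → pivotWeight t (suc m) (insertAfter y w))
pivotWeight-suc {n} t m w with ind-0∨1 (pivot? m w)
... | inj₂ eq = begin
  pivotWeight (suc t) m w
    ≡⟨ isOne refl _ ⟩
  weight (suc t) (pivotColour m w)
    ≡⟨ weight-suc t (pivotColour m w) (pivotColour (suc m) (prepend w)) (λ y → pivotWeight t (suc m) (insertAfter y w))
         (cong (colour false true) (isLonely-0-prepend w))
         (pivotColour-prepend m w)
         (λ y χy≡pivot → dead (pivotColour≡pivot m w y χy≡pivot))
         (λ y χy≢pivot → _ , pivotColour-inserted w (notPivot χy≢pivot) , live (notPivot χy≢pivot)) ⟩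
  weight t (pivotColour (suc m) (prepend w)) + sumFin (λ y → pivotWeight t (suc m) (insertAfter y w))
    ≡⟨ cong (_+ sumFin (λ y → pivotWeight t (suc m) (insertAfter y w))) atFront ⟨
  pivotWeight t (suc m) (prepend w) + sumFin (λ y → pivotWeight t (suc m) (insertAfter y w)) ∎
  where
  open ≡-Reasoning
  isOne : ∀ {i} → i ≡ ind (pivot? m w) → ∀ x → i * x ≡ x
  isOne i≡ x = trans (cong (_* x) (trans i≡ eq)) (*-identityˡ x)
  atFront : pivotWeight t (suc m) (prepend w) ≡ weight t (pivotColour (suc m) (prepend w))
  atFront = isOne (pivot-prepend m w) _
  dead : ∀ {y} → y ≡ m → pivotWeight t (suc m) (insertAfter y w) ≡ 0
  dead refl = cong (_* weight t (pivotColour (suc m) (insertAfter m w))) (pivot-insertAfter-self m w)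
  notPivot : ∀ {y} → pivotColour m w y ≢ pivot → y ≢ m
  notPivot χy≢pivot refl with m ≟ m
  ... | yes _  = χy≢pivot refl
  ... | no m≢m = m≢m refl
  live : ∀ {y} → y ≢ m → pivotWeight t (suc m) (insertAfter y w) ≡ weight t (pivotColour (suc m) (insertAfter y w))
  live y≢m = isOne (pivot-insertAfter w y≢m) _
... | inj₁ eq = trans (isZero refl _) (sym (cong₂ _+_
  (isZero (pivot-prepend m w) _) (trans (sumFin-cong zeros) (sumFin-0 n))))
  where
  isZero : ∀ {i} → i ≡ ind (pivot? m w) → ∀ x → i * x ≡ 0
  isZero i≡ x = cong (_* x) (trans i≡ eq)
  zeros : ∀ y → pivotWeight t (suc m) (insertAfter y w) ≡ 0
  zeros y with y ≟ m
  ... | yes refl = cong (_* weight t (pivotColour (suc m) (insertAfter m w))) (pivot-insertAfter-self m w)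
  ... | no y≢m   = isZero (pivot-insertAfter w y≢m) _

increasing-prepend : (w : List (Fin n)) → ind (increasing? (prepend w)) ≡ ind (increasing? w)
increasing-prepend w = ind-cong (increasing? (prepend w)) (increasing? w)
  (λ inc x y x<y → trans (sym (precedes-map-suc y x w)) (inc (suc x) (suc y) (s≤s x<y))) from
  where
  from : IncreasingWord w → IncreasingWord (prepend w)
  from inc zero    (suc y) _         = refl
  from inc (suc x) (suc y) (s≤s x<y) = trans (precedes-map-suc y x w) (inc x y x<y)

-- A smallest entry inserted after any `y` is preceded by a larger one, so in each step only the
-- insertion at the front survives.
sumOver-increasing : ∀ n → sumOver (𝒮ʷ n) (ind ∘ increasing?) ≡ 1
sumOver-increasing zero    = refl
sumOver-increasing (suc n) = begin
  sumOver (𝒮ʷ (suc n)) (ind ∘ increasing?)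
    ≡⟨ sumOver-𝒮ʷ-suc n (ind ∘ increasing?) ⟩
  sumOver (𝒮ʷ n) (λ w → ind (increasing? (prepend w)) + sumFin (λ y → ind (increasing? (insertAfter y w))))
    ≡⟨ sumOver-cong (𝒮ʷ n) (λ {w} w∈ → trans (cong₂ _+_ (increasing-prepend w) (none w∈)) (+-identityʳ _)) ⟩
  sumOver (𝒮ʷ n) (ind ∘ increasing?)
    ≡⟨ sumOver-increasing n ⟩
  1 ∎
  where
  open ≡-Reasoning
  none : ∀ {w} → w ∈ 𝒮ʷ n → sumFin (λ y → ind (increasing? (insertAfter y w))) ≡ 0
  none {w} w∈ = trans (sumFin-cong (λ y → ind-no (increasing? (insertAfter y w)) (λ inc →
      case trans (sym (inc zero (suc y) z<s))
        (precedes-insertAfter-0 (let (w! , len) = ∈-𝒮ʷ⁻ w∈ in unique⇒complete w! len y)) of λ ())))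
    (sumFin-0 n)

sumFin-1 : ∀ n → sumFin {n} (λ _ → 1) ≡ n
sumFin-1 zero    = refl
sumFin-1 (suc n) = cong suc (sumFin-1 n)

-- Here the pivot is the entry just inserted. All `n` old entries are larger and behind it, so the
-- condition on them is that `w` increases.
pivotWeight-0-prepend : ∀ t (w : List (Fin n)) →
  pivotWeight t zero (prepend w) ≡ W t 0 0 n * ind (increasing? w)
pivotWeight-0-prepend {n} t w = trans (cong₂ _*_ isPivot allAfter) (*-comm (ind (increasing? w)) _)
  where
  allAfter : weight t (pivotColour zero (prepend w)) ≡ W t 0 0 n
  allAfter = trans (cong₂ (λ k b → W t k b (sumFin {n} (λ _ → 1))) (sumFin-0 n) (sumFin-0 n))
    (cong (W t 0 0) (sumFin-1 n))
  to : Pivot zero (prepend w) → IncreasingWord w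
  to (_ , inc) x y x<y = trans (sym (precedes-map-suc y x w)) (inc (suc x) (suc y) z<s (s≤s x<y))
  from : IncreasingWord w → Pivot zero (prepend w)
  from inc = isLonely-0-prepend w , λ where
    (suc x) (suc y) _ (s≤s x<y) → trans (precedes-map-suc y x w) (inc x y x<y)
  isPivot : ind (pivot? zero (prepend w)) ≡ ind (increasing? w)
  isPivot = ind-cong (pivot? zero (prepend w)) (increasing? w) to from

pivotWeight-0-insertAfter : ∀ t y (w : List (Fin n)) → pivotWeight t zero (insertAfter y w) ≡ 0
pivotWeight-0-insertAfter t y w = cong (_* weight t (pivotColour zero (insertAfter y w)))
  (ind-no (pivot? zero (insertAfter y w)) (λ (l , _) → case trans (sym l) (isLonely-0-insertAfter y w) of λ ()))

sumOver-*ˡ : ∀ {A : Set} (xs : List A) c (f : A → ℕ) → sumOver xs (λ x → c * f x) ≡ c * sumOver xs f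
sumOver-*ˡ []       c f = sym (*-zeroʳ c)
sumOver-*ˡ (x ∷ xs) c f = trans (cong (c * f x +_) (sumOver-*ˡ xs c f)) (sym (*-distribˡ-+ c (f x) _))

-- Removing the smallest entry lowers the pivot and the size by one and raises `t` by one, so
-- `toℕ m + t` and the number of entries above the pivot are kept. When the pivot itself is
-- smallest, only the increasing word contributes.
sumOver-pivotWeight : ∀ n t (m : Fin n) → sumOver (𝒮ʷ n) (pivotWeight t m) ≡ W (toℕ m + t) 0 0 (n ∸ suc (toℕ m))
sumOver-pivotWeight (suc n) t zero = begin
  sumOver (𝒮ʷ (suc n)) (pivotWeight t zero)
    ≡⟨ sumOver-𝒮ʷ-suc n (pivotWeight t zero) ⟩
  sumOver (𝒮ʷ n) (λ w → pivotWeight t zero (prepend w) + sumFin (λ y → pivotWeight t zero (insertAfter y w)))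
    ≡⟨ sumOver-cong (𝒮ʷ n) (λ {w} _ → trans (cong₂ _+_ (pivotWeight-0-prepend t w)
         (trans (sumFin-cong (λ y → pivotWeight-0-insertAfter t y w)) (sumFin-0 n))) (+-identityʳ _)) ⟩
  sumOver (𝒮ʷ n) (λ w → W t 0 0 n * ind (increasing? w))
    ≡⟨ sumOver-*ˡ (𝒮ʷ n) (W t 0 0 n) _ ⟩
  W t 0 0 n * sumOver (𝒮ʷ n) (ind ∘ increasing?)
    ≡⟨ trans (cong (W t 0 0 n *_) (sumOver-increasing n)) (*-identityʳ _) ⟩
  W t 0 0 n ∎
  where open ≡-Reasoning
sumOver-pivotWeight (suc n) t (suc m) = begin
  sumOver (𝒮ʷ (suc n)) (pivotWeight t (suc m))
    ≡⟨ sumOver-𝒮ʷ-suc n (pivotWeight t (suc m)) ⟩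
  sumOver (𝒮ʷ n) (λ w → pivotWeight t (suc m) (prepend w) + sumFin (λ y → pivotWeight t (suc m) (insertAfter y w)))
    ≡⟨ sumOver-cong (𝒮ʷ n) (λ {w} _ → pivotWeight-suc t m w) ⟨
  sumOver (𝒮ʷ n) (pivotWeight (suc t) m)
    ≡⟨ sumOver-pivotWeight n (suc t) m ⟩
  W (toℕ m + suc t) 0 0 (n ∸ suc (toℕ m))
    ≡⟨ cong (λ e → W e 0 0 (n ∸ suc (toℕ m))) (+-suc (toℕ m) t) ⟩
  W (suc (toℕ m) + t) 0 0 (n ∸ suc (toℕ m)) ∎
  where open ≡-Reasoning

≟-≡ : {x y : Fin n} → x ≡ y → does (x ≟ y) ≡ true
≟-≡ {x = x} {y} x≡y with x ≟ y
... | yes _  = refl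
... | no x≢y = ⊥-elim (x≢y x≡y)

≟-≢ : {x y : Fin n} → x ≢ y → does (x ≟ y) ≡ false
≟-≢ {x = x} {y} x≢y with x ≟ y
... | yes x≡y = ⊥-elim (x≢y x≡y)
... | no _    = refl

≟-true : {x y : Fin n} → does (x ≟ y) ≡ true → x ≡ y
≟-true {x = x} {y} eq with x ≟ y
... | yes x≡y = x≡y

-- Fixed points of π̂ are the lonely elements

cycleImage-self : (x : Fin n) → cycleImage (x ∷ []) x ≡ just x
cycleImage-self x with x ≟ x
... | yes _  = refl
... | no x≢x = ⊥-elim (x≢x refl)

cycleImage-head : ∀ (x d : Fin n) ds → cycleImage (x ∷ d ∷ ds) x ≡ just d
cycleImage-head x d ds with x ≟ x
... | yes _  = refl
... | no x≢x = ⊥-elim (x≢x refl)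

cycleImage-last : ∀ {x c : Fin n} → c ≢ x → cycleImage (c ∷ x ∷ []) x ≡ just c
cycleImage-last {x = x} {c} c≢x with c ≟ x
... | yes c≡x = ⊥-elim (c≢x c≡x)
... | no _ with x ≟ x
... | yes _  = refl
... | no x≢x = ⊥-elim (x≢x refl)

cycleImage-second : ∀ {x c e : Fin n} ds → c ≢ x → cycleImage (c ∷ x ∷ e ∷ ds) x ≡ just e
cycleImage-second {x = x} {c} ds c≢x with c ≟ x
... | yes c≡x = ⊥-elim (c≢x c≡x)
... | no _ with x ≟ x
... | yes _  = refl
... | no x≢x = ⊥-elim (x≢x refl)

-- Induction on a cycle removes its second entry, as the first one is needed to close it.
cycleImage-drop : ∀ {x c d : Fin n} ds → c ≢ x → d ≢ x →
  cycleImage (c ∷ d ∷ ds) x ≡ cycleImage (c ∷ ds) x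
cycleImage-drop {x = x} {c} {d} ds c≢x d≢x with c ≟ x
... | yes c≡x = ⊥-elim (c≢x c≡x)
... | no _ with d ≟ x
... | yes d≡x = ⊥-elim (d≢x d≡x)
cycleImage-drop []       c≢x d≢x | no _ | no _ = refl
cycleImage-drop (_ ∷ _) c≢x d≢x | no _ | no _ = refl

cycleImage-∉ : ∀ {x c : Fin n} cs → x ∉ c ∷ cs → cycleImage (c ∷ cs) x ≡ nothing
cycleImage-∉ {x = x} {c} [] x∉ with c ≟ x
... | yes refl = ⊥-elim (x∉ (here refl))
... | no _     = refl
cycleImage-∉ (d ∷ ds) x∉ =
  trans (cycleImage-drop ds (λ c≡x → x∉ (here (sym c≡x))) (λ d≡x → x∉ (there (here (sym d≡x)))))
        (cycleImage-∉ ds λ { (here eq) → x∉ (here eq) ; (there x∈) → x∉ (there (there x∈)) })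

-- In a cycle of at least two distinct entries, the successor of `x` is another entry; for the last
-- entry it is the first. The decisions are arguments so that the recursion can keep `c ≢ x` while
-- it shortens the cycle.
cycleImage-moves : ∀ {x c d : Fin n} → Dec (c ≡ x) → Dec (d ≡ x) → ∀ ds → Unique (c ∷ d ∷ ds) → x ∈ c ∷ d ∷ ds →
  ∃[ z ] cycleImage (c ∷ d ∷ ds) x ≡ just z × z ≢ x
cycleImage-moves {x = x} {d = d} (yes refl) _ ds ((c≢d ∷ _) ∷ _) _ =
  d , cycleImage-head x d ds , c≢d ∘ sym
cycleImage-moves {c = c} (no c≢x) (yes refl) [] _ _ = c , cycleImage-last c≢x , c≢x
cycleImage-moves (no c≢x) (yes refl) (e ∷ ds) (_ ∷ ((d≢e ∷ _) ∷ _)) _ =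
  e , cycleImage-second ds c≢x , d≢e ∘ sym
cycleImage-moves (no c≢x) (no _) ds _ (here refl) = ⊥-elim (c≢x refl)
cycleImage-moves (no _) (no d≢x) ds _ (there (here refl)) = ⊥-elim (d≢x refl)
cycleImage-moves {x = x} (no c≢x) (no d≢x) (e ∷ ds) ((_ ∷ c∉) ∷ (_ ∷ ds!)) (there (there x∈)) =
  let (z , eq , z≢x) = cycleImage-moves (no c≢x) (e ≟ x) ds (c∉ ∷ ds!) (there x∈) in
  z , trans (cycleImage-drop (e ∷ ds) c≢x d≢x) eq , z≢x

flatten : List (List⁺ (Fin n)) → List (Fin n)
flatten []             = []
flatten ((a ∷ c) ∷ cs) = a ∷ c ++ flatten cs

flatten-breakAtMaxima : ∀ (a : Fin n) w → let (c , cs) = breakAtMaxima a w in c ++ flatten cs ≡ w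
flatten-breakAtMaxima a []      = refl
flatten-breakAtMaxima a (b ∷ w) with a <? b
... | yes _ = cong (b ∷_) (flatten-breakAtMaxima b w)
... | no  _ = cong (b ∷_) (flatten-breakAtMaxima a w)

-- Carries distinctness and completeness from the word over to its cycles.
flatten-cycleForm : (w : List (Fin n)) → flatten (cycleForm w) ≡ w
flatten-cycleForm []      = refl
flatten-cycleForm (a ∷ w) = cong (a ∷_) (flatten-breakAtMaxima a w)

Unique-++⁻ : {A : Set} (xs : List A) {ys : List A} → Unique (xs ++ ys) →
  Unique xs × Unique ys × (∀ {z} → z ∈ xs → z ∉ ys)
Unique-++⁻ []       ys!        = [] , ys! , λ ()
Unique-++⁻ (x ∷ xs) (x∉ ∷ xs!) = let (xs! , ys! , disjoint) = Unique-++⁻ xs xs! in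
  All.tabulate (λ z∈ → All.lookup x∉ (∈-++⁺ˡ z∈)) ∷ xs! , ys! , λ where
    (here refl) z∈ys → All.lookup x∉ (∈-++⁺ʳ xs z∈ys) refl
    (there z∈)       → disjoint z∈

∉⇒notSingleton : ∀ {x : Fin n} c cs → x ∉ c ∷ cs → isSingleton x (c ∷ cs) ≡ false
∉⇒notSingleton c []      x∉ = ≟-≢ (λ c≡x → x∉ (here (sym c≡x)))
∉⇒notSingleton c (_ ∷ _) x∉ = refl

∉⇒noSingleton : ∀ {x : Fin n} css → x ∉ flatten css → any (isSingleton x) css ≡ false
∉⇒noSingleton []               x∉ = refl
∉⇒noSingleton ((c ∷ cs) ∷ css) x∉ =
  cong₂ _∨_ (∉⇒notSingleton c cs (x∉ ∘ ∈-++⁺ˡ)) (∉⇒noSingleton css (x∉ ∘ ∈-++⁺ʳ (c ∷ cs)))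

-- The search inside `hat`, before the default is applied.
image : List (List⁺ (Fin n)) → Fin n → Maybe (Fin n)
image css x = foldr (λ c r → cycleImage c x <∣> r) nothing css

-- Cycles without `x` yield `nothing` and no singleton, so the single cycle containing `x` decides
-- both the image and the loneliness.
image-fixed : ∀ {x : Fin n} css → Unique (flatten css) → x ∈ flatten css →
  ∃[ z ] image css x ≡ just z × (z ≡ x → any (isSingleton x) css ≡ true) × (any (isSingleton x) css ≡ true → z ≡ x)
image-fixed {x = x} ((c ∷ cs) ∷ css) css! x∈
  with Unique-++⁻ (c ∷ cs) css! | ∈-++⁻ (c ∷ cs) x∈
... | _ , css!′ , disjoint | inj₂ x∈css
  rewrite cycleImage-∉ cs (λ x∈c → disjoint x∈c x∈css) | ∉⇒notSingleton c cs (λ x∈c → disjoint x∈c x∈css) =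
  image-fixed css css!′ x∈css
image-fixed {x = x} ((c ∷ []) ∷ css) css! x∈ | _ | inj₁ (here refl)
  rewrite cycleImage-self x | ≟-≡ {x = x} refl = x , refl , (λ _ → refl) , (λ _ → refl)
image-fixed {x = x} ((c ∷ d ∷ ds) ∷ css) css! x∈ | c! , _ , disjoint | inj₁ x∈c
  with cycleImage-moves (c ≟ x) (d ≟ x) ds c! x∈c
... | z , eq , z≢x rewrite eq = z , refl , (λ z≡x → ⊥-elim (z≢x z≡x)) ,
  λ lonely → case trans (sym lonely) (∉⇒noSingleton css (disjoint x∈c)) of λ ()

hat-fixed : ∀ {π : Vec (Fin n) n} → π ∈ 𝒮 n → ∀ x →
  (hat π x ≡ x → isLonely x (toList π) ≡ true) × (isLonely x (toList π) ≡ true → hat π x ≡ x)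
hat-fixed {n} {π} π∈ x with ∈-𝒮ʷ⁻ (∈-map⁺ toList π∈)
... | w! , len with image-fixed (cycleForm (toList π))
      (subst Unique (sym (flatten-cycleForm (toList π))) w!)
      (subst (x ∈_) (sym (flatten-cycleForm (toList π))) (unique⇒complete w! len x))
... | z , eq , to , from = (λ h → to (trans (sym hat≡z) h)) , (λ l → trans hat≡z (from l))
  where
  -- The search ends in `just z`, so `z` is returned and not the default `x`, which would pass for a
  -- fixed point.
  hat≡z : hat π x ≡ z
  hat≡z = cong (fromMaybe x) eq

-- Order of the entries of a word

∨-true : ∀ a {b} → a ∨ b ≡ true → a ≡ true ⊎ b ≡ true
∨-true true  _  = inj₁ refl
∨-true false eq = inj₂ eq

isSingleton⇒≡ : ∀ {b x : Fin n} c → isSingleton x (b ∷ c) ≡ true → b ≡ x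
isSingleton⇒≡ [] eq = ≟-true eq

precedes-∷⁻ : ∀ (y x b : Fin n) w → precedes y x (b ∷ w) ≡ true → b ≢ x × (b ≡ y ⊎ precedes y x w ≡ true)
precedes-∷⁻ y x b w p with b ≟ x | b ≟ y
... | no b≢x | yes b≡y = b≢x , inj₁ b≡y
... | no b≢x | no _    = b≢x , inj₂ p

-- `a` is the running maximum, and only cycles opened later are inspected. Such a cycle begins with
-- an entry above the running maximum, which bounds everything read before it.
breakAtMaxima-lonely : ∀ (a x : Fin n) w → any (isSingleton x) (proj₂ (breakAtMaxima a w)) ≡ true →
  a <ᶠ x × (∀ y → precedes y x w ≡ true → y <ᶠ x)
breakAtMaxima-lonely a x (b ∷ w) l with a <? b
breakAtMaxima-lonely a x (b ∷ w) l | yes a<b with ∨-true (isSingleton x (b ∷ proj₁ (breakAtMaxima b w))) l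
... | inj₁ eq = subst (a <ᶠ_) b≡x a<b , λ y p → ⊥-elim (proj₁ (precedes-∷⁻ y x b w p) b≡x)
  where b≡x = isSingleton⇒≡ (proj₁ (breakAtMaxima b w)) eq
... | inj₂ l′ = let (b<x , below) = breakAtMaxima-lonely b x w l′ in <-trans a<b b<x , λ y p →
  case proj₂ (precedes-∷⁻ y x b w p) of λ where
    (inj₁ refl) → b<x
    (inj₂ p′)   → below y p′
breakAtMaxima-lonely a x (b ∷ w) l | no a≮b = let (a<x , below) = breakAtMaxima-lonely a x w l in a<x , λ y p →
  case proj₂ (precedes-∷⁻ y x b w p) of λ where
    (inj₁ refl) → ≤-<-trans (≮⇒≥ a≮b) a<x
    (inj₂ p′)   → below y p′

-- A one-element cycle is its own opening entry, hence a left-to-right maximum.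
lonely-maximum : ∀ {x y : Fin n} w → isLonely x w ≡ true → precedes y x w ≡ true → y <ᶠ x
lonely-maximum {x = x} {y} (a ∷ w) l p
  with ∨-true (isSingleton x (a ∷ proj₁ (breakAtMaxima a w))) l | precedes-∷⁻ y x a w p
... | inj₁ eq | a≢x , _       = ⊥-elim (a≢x (isSingleton⇒≡ (proj₁ (breakAtMaxima a w)) eq))
... | inj₂ l′ | _ , inj₁ refl = proj₁ (breakAtMaxima-lonely a x w l′)
... | inj₂ l′ | _ , inj₂ p′   = proj₂ (breakAtMaxima-lonely a x w l′) y p′

precedes-total : ∀ {x y : Fin n} {w} → x ≢ y → x ∈ w → y ∈ w → precedes x y w ≡ true ⊎ precedes y x w ≡ true
precedes-total {x = x} {y} {z ∷ w} x≢y x∈ y∈ with z ≟ x | z ≟ y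
... | yes refl | yes refl = ⊥-elim (x≢y refl)
... | yes _    | no _     = inj₁ refl
... | no _     | yes _    = inj₂ refl
precedes-total x≢y (here refl) _           | no z≢x | no _   = ⊥-elim (z≢x refl)
precedes-total x≢y (there _)   (here refl) | no _   | no z≢y = ⊥-elim (z≢y refl)
precedes-total x≢y (there x∈)  (there y∈)  | no _   | no _   = precedes-total x≢y x∈ y∈

lookup-∈ : (v : Vec (Fin n) k) → ∀ i → lookup v i ∈ toList v
lookup-∈ (_ ∷ v) zero    = here refl
lookup-∈ (_ ∷ v) (suc i) = there (lookup-∈ v i)

∈-lookup : ∀ {x} (v : Vec (Fin n) k) → x ∈ toList v → ∃[ i ] lookup v i ≡ x
∈-lookup (_ ∷ v) (here refl) = zero , refl
∈-lookup (_ ∷ v) (there x∈)  = let (i , eq) = ∈-lookup v x∈ in suc i , eq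

precedes⁺ : ∀ {v : Vec (Fin n) k} → Unique (toList v) → ∀ {i j} → i <ᶠ j →
  precedes (lookup v i) (lookup v j) (toList v) ≡ true
precedes⁺ {v = z ∷ v} (z∉ ∷ v!) {zero} {suc j} _
  rewrite ≟-≢ (All.lookup z∉ (lookup-∈ v j)) | ≟-≡ {x = z} refl = refl
precedes⁺ {v = z ∷ v} (z∉ ∷ v!) {suc i} {suc j} (s≤s i<j)
  rewrite ≟-≢ (All.lookup z∉ (lookup-∈ v j)) | ≟-≢ (All.lookup z∉ (lookup-∈ v i)) = precedes⁺ v! i<j

precedes⁻ : ∀ {y x} (v : Vec (Fin n) k) → precedes y x (toList v) ≡ true → x ∈ toList v →
  ∃[ i ] ∃[ j ] i <ᶠ j × lookup v i ≡ y × lookup v j ≡ x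
precedes⁻ {y = y} {x} (z ∷ v) p x∈ with precedes-∷⁻ y x z (toList v) p
precedes⁻ (z ∷ v) p (here refl) | z≢x , _ = ⊥-elim (z≢x refl)
precedes⁻ (z ∷ v) p (there x∈)  | _ , inj₁ refl =
  let (j , eq) = ∈-lookup v x∈ in zero , suc j , z<s , refl , eq
precedes⁻ (z ∷ v) p (there x∈)  | _ , inj₂ p′ =
  let (i , j , i<j , eqs) = precedes⁻ v p′ x∈ in suc i , suc j , s≤s i<j , eqs

-- Avoidance

AllPivots : List (Fin n) → Set
AllPivots w = ∀ x → isLonely x w ≡ true → IncreasingAbove x w

allPivots? : (w : List (Fin n)) → Dec (AllPivots w)
allPivots? w = all? λ x → (isLonely x w Bool.≟ true) →-dec increasingAbove? x w

NoLonely : List (Fin n) → Set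
NoLonely w = ∀ x → isLonely x w ≡ false

noLonely? : (w : List (Fin n)) → Dec (NoLonely w)
noLonely? w = all? λ x → isLonely x w Bool.≟ false

LeastLonely : List (Fin n) → Fin n → Set
LeastLonely w m = isLonely m w ≡ true × IncreasingAbove m w × (∀ x → x <ᶠ m → isLonely x w ≡ false)

leastLonely? : (w : List (Fin n)) (m : Fin n) → Dec (LeastLonely w m)
leastLonely? w m = (isLonely m w Bool.≟ true) ×-dec (increasingAbove? m w ×-dec
  all? λ x → (x <? m) →-dec (isLonely x w Bool.≟ false))

-- An occurrence amounts to `x < a < b` with `x` fixed by π̂ and `b` standing before `a`;
-- `hat-fixed` turns the fixed point into a lonely entry.
avoids⇔allPivots : ∀ {π : Vec (Fin n) n} → π ∈ 𝒮 n →
  (Avoids π ⟨32⨾1→1⟩ → AllPivots (toList π)) × (AllPivots (toList π) → Avoids π ⟨32⨾1→1⟩)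
avoids⇔allPivots {n} {π} π∈ = to , from
  where
  w  = toList π
  w! = proj₁ (∈-𝒮ʷ⁻ (∈-map⁺ toList π∈))
  len = proj₂ (∈-𝒮ʷ⁻ (∈-map⁺ toList π∈))
  to : Avoids π ⟨32⨾1→1⟩ → AllPivots w
  to avoids x l a b x<a a<b with precedes b a w in p
  ... | false = refl
  ... | true  = let (i , j , i<j , πi≡b , πj≡a) = precedes⁻ π p (unique⇒complete w! len a) in
    -- The values are listed increasingly and the positions from left to right; the word 32 puts the
    -- larger value `b` at the earlier position `i`.
    ⊥-elim (avoids ((x ∷ a ∷ b ∷ []) , (i ∷ j ∷ []) ,
      (x<a VecAll.∷ <-trans x<a a<b VecAll.∷ VecAll.[]) VecAllPairs.∷ (a<b VecAll.∷ VecAll.[])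
        VecAllPairs.∷ VecAll.[] VecAllPairs.∷ VecAllPairs.[] ,
      (i<j VecAll.∷ VecAll.[]) VecAllPairs.∷ VecAll.[] VecAllPairs.∷ VecAllPairs.[] ,
      cong₂ (λ u v → u ∷ v ∷ []) πi≡b πj≡a ,
      (proj₂ (hat-fixed π∈ x) l ∷ [])))
  from : AllPivots w → Avoids π ⟨32⨾1→1⟩
  from pivots ((x ∷ a ∷ b ∷ []) , (i ∷ j ∷ []) ,
      (x<a VecAll.∷ _) VecAllPairs.∷ (a<b VecAll.∷ _) VecAllPairs.∷ _ ,
      (i<j VecAll.∷ _) VecAllPairs.∷ _ , eq , (fixed ∷ []))
    with ∷-injective eq
  ... | refl , eq′ with ∷-injective eq′
  ... | refl , _ = case trans (sym (precedes⁺ w! i<j)) (pivots x (proj₁ (hat-fixed π∈ x) fixed) a b x<a a<b) of λ ()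

-- As `Q` is inherited upwards, it holds wherever `P` does as soon as it holds at the least such
-- place. That place is unique, so the indicators add up without overlap.
ind-least : ∀ {n} (P : Fin n → Bool) (Q : Fin n → Set) → (∀ {x y} → x <ᶠ y → Q x → Q y) →
  (A? : Dec (∀ x → P x ≡ true → Q x)) (N? : Dec (∀ x → P x ≡ false))
  (L? : ∀ m → Dec (P m ≡ true × Q m × (∀ x → x <ᶠ m → P x ≡ false))) →
  ind A? ≡ ind N? + sumFin (ind ∘ L?)
ind-least {zero} P Q mono A? N? L? = trans (ind-yes A? λ ()) (sym (trans (+-identityʳ _) (ind-yes N? λ ())))
ind-least {suc n} P Q mono A? N? L? with P zero in eq
... | true = begin
  ind A?                      ≡⟨ ind-cong A? (L? zero) (λ a → eq , a zero eq , λ x ()) fromLeast ⟩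
  ind (L? zero)               ≡⟨ +-identityʳ _ ⟨
  ind (L? zero) + 0           ≡⟨ cong (ind (L? zero) +_) (trans (sumFin-cong notLeast) (sumFin-0 n)) ⟨
  sumFin (ind ∘ L?)           ≡⟨ cong (_+ sumFin (ind ∘ L?)) (ind-no N? (λ none → case trans (sym eq) (none zero) of λ ())) ⟨
  ind N? + sumFin (ind ∘ L?)  ∎
  where
  open ≡-Reasoning
  fromLeast : P zero ≡ true × Q zero × (∀ x → x <ᶠ zero {n} → P x ≡ false) → ∀ x → P x ≡ true → Q x
  fromLeast (_ , q , _) zero    _ = q
  fromLeast (_ , q , _) (suc x) _ = mono z<s q
  notLeast : ∀ m → ind (L? (suc m)) ≡ 0
  notLeast m = ind-no (L? (suc m)) (λ (_ , _ , least) → case trans (sym eq) (least zero z<s) of λ ())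
... | false = begin
  ind A?                                               ≡⟨ ind-cong A? A′? (λ a x → a (suc x)) toA ⟩
  ind A′?                                              ≡⟨ ind-least (P ∘ suc) (Q ∘ suc) (λ x<y → mono (s≤s x<y)) A′? N′? L′? ⟩
  ind N′? + sumFin (ind ∘ L′?)                         ≡⟨⟩
  ind N? + (0 + sumFin (ind ∘ L? ∘ suc))               ≡⟨ cong (λ i → ind N? + (i + sumFin (ind ∘ L? ∘ suc)))
                                                           (ind-no (L? zero) (λ (l , _) → case trans (sym l) eq of λ ())) ⟨
  ind N? + sumFin (ind ∘ L?)                           ∎
  where
  open ≡-Reasoning
  toA : (∀ x → P (suc x) ≡ true → Q (suc x)) → ∀ x → P x ≡ true → Q x
  toA a zero    p = case trans (sym p) eq of λ ()
  toA a (suc x) p = a x p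
  toN : (∀ x → P (suc x) ≡ false) → ∀ x → P x ≡ false
  toN none zero    = eq
  toN none (suc x) = none x
  toL : ∀ {m} → (∀ x → x <ᶠ m → P (suc x) ≡ false) → ∀ x → x <ᶠ suc m → P x ≡ false
  toL none zero    _         = eq
  toL none (suc x) (s≤s x<m) = none x x<m
  -- `map′` keeps `does`, so the indicators of `N′?` and `L′?` compute to those of `N?` and `L?`;
  -- the empty step above relies on this.
  A′? = map′ (λ a x → a (suc x)) toA A?
  N′? = map′ (λ none x → none (suc x)) toN N?
  L′? = λ m → map′ (λ (p , q , none) → p , q , λ x x<m → none (suc x) (s≤s x<m))
                   (λ (p , q , none) → p , q , toL none) (L? (suc m))

ind-* : {P R : Set} (P? : Dec P) (R? : Dec R) → (R → P) → ∀ {x} → (P → x ≡ ind R?) → ind P? * x ≡ ind R?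
ind-* (yes p) R? R⇒P eq = trans (*-identityˡ _) (eq p)
ind-* (no ¬p) R? R⇒P eq = sym (ind-no R? (¬p ∘ R⇒P))

pivotColour-lonely : ∀ {m x : Fin n} w → pivotColour m w x ≡ lonely → precedes x m w ≡ true × isLonely x w ≡ true
pivotColour-lonely {m = m} {x} w eq with x ≟ m | precedes x m w | isLonely x w
... | no _ | true | true = refl , refl
pivotColour-lonely w () | yes _ | _     | _
pivotColour-lonely w () | no _  | true  | false
pivotColour-lonely w () | no _  | false | _

lonely-pivotColour : ∀ {m x : Fin n} w → x ≢ m → precedes x m w ≡ true → isLonely x w ≡ true →
  pivotColour m w x ≡ lonely
lonely-pivotColour {m = m} {x} w x≢m p l rewrite ≟-≢ x≢m | p | l = refl

-- The colours see only lonely entries in front of `m`, whereas leastness concerns all lonely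
-- entries below `m`. These are the same, as a lonely entry exceeds everything in front of it.
pivotWeight-0 : ∀ {w : List (Fin n)} → w ∈ 𝒮ʷ n → ∀ m → pivotWeight 0 m w ≡ ind (leastLonely? w m)
pivotWeight-0 {w = w} w∈ m = ind-* (pivot? m w) (leastLonely? w m) (λ (l , inc , _) → l , inc)
  λ (l , inc) → weight-0 (pivotColour m w) (leastLonely? w m)
    (λ (_ , _ , least) i eq → let (p , li) = pivotColour-lonely w eq in
      case trans (sym li) (least i (lonely-maximum w l p)) of λ ())
    (λ none → l , inc , λ x x<m → least l none x x<m)
  where
  complete : ∀ x → x ∈ w
  complete = let (w! , len) = ∈-𝒮ʷ⁻ w∈ in unique⇒complete w! len
  least : isLonely m w ≡ true → (∀ i → pivotColour m w i ≢ lonely) → ∀ x → x <ᶠ m → isLonely x w ≡ false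
  least l none x x<m with isLonely x w in lx
  ... | false = refl
  ... | true with precedes-total (Fin.<⇒≢ x<m) (complete x) (complete m)
  ... | inj₁ p = ⊥-elim (none x (lonely-pivotColour w (Fin.<⇒≢ x<m) p lx))
  ... | inj₂ p = ⊥-elim (<-asym x<m (lonely-maximum w lx p))

lonelyWeight-0 : (w : List (Fin n)) → weight 0 (lonelyColour w) ≡ ind (noLonely? w)
lonelyWeight-0 w = weight-0 (lonelyColour w) (noLonely? w) to from
  where
  to : NoLonely w → ∀ i → lonelyColour w i ≢ lonely
  to none i eq rewrite none i = case eq of λ ()
  from : (∀ i → lonelyColour w i ≢ lonely) → NoLonely w
  from none x with isLonely x w in l
  ... | false = refl
  ... | true  = ⊥-elim (none x (cong (if_then lonely else before) l))

-- Assembling the formula.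

length-𝒮-avoiding : ∀ n → length (𝒮-avoiding n ⟨32⨾1→1⟩) ≡
  W n 0 0 0 + sumFin {n} (λ m → W (toℕ m) 0 0 (n ∸ suc (toℕ m)))
length-𝒮-avoiding n = begin
  length (𝒮-avoiding n ⟨32⨾1→1⟩)
    ≡⟨ length-filter≡sumOver (avoids? ⟨32⨾1→1⟩) (𝒮 n) ⟩
  sumOver (𝒮 n) (ind ∘ avoids? ⟨32⨾1→1⟩)
    ≡⟨ sumOver-cong (𝒮 n) (λ {π} π∈ → let (to , from) = avoids⇔allPivots π∈ in
         ind-cong (avoids? ⟨32⨾1→1⟩ π) (allPivots? (toList π)) to from) ⟩
  sumOver (𝒮 n) (ind ∘ allPivots? ∘ toList)
    ≡⟨ sumOver-map toList (𝒮 n) (ind ∘ allPivots?) ⟨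
  sumOver (𝒮ʷ n) (ind ∘ allPivots?)
    ≡⟨ sumOver-cong (𝒮ʷ n) (λ {w} w∈ → trans
         (ind-least (λ x → isLonely x w) (λ x → IncreasingAbove x w) (λ x<y inc a b y<a → inc a b (<-trans x<y y<a))
           (allPivots? w) (noLonely? w) (leastLonely? w))
         (sym (cong₂ _+_ (lonelyWeight-0 w) (sumFin-cong (pivotWeight-0 w∈))))) ⟩
  sumOver (𝒮ʷ n) (λ w → weight 0 (lonelyColour w) + sumFin (λ m → pivotWeight 0 m w))
    ≡⟨ sumOver-+ (𝒮ʷ n) _ _ ⟩
  sumOver (𝒮ʷ n) (weight 0 ∘ lonelyColour) + sumOver (𝒮ʷ n) (λ w → sumFin (λ m → pivotWeight 0 m w))
    ≡⟨ cong₂ _+_ (sumOver-lonelyColour n 0) (sumOver-sumFin (𝒮ʷ n) (λ w m → pivotWeight 0 m w)) ⟩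
  W (n + 0) 0 0 0 + sumFin (λ m → sumOver (𝒮ʷ n) (pivotWeight 0 m))
    ≡⟨ cong₂ _+_ (cong (λ e → W e 0 0 0) (+-identityʳ n)) (sumFin-cong λ m →
         trans (sumOver-pivotWeight n 0 m) (cong (λ e → W e 0 0 (n ∸ suc (toℕ m))) (+-identityʳ (toℕ m)))) ⟩
  W n 0 0 0 + sumFin {n} (λ m → W (toℕ m) 0 0 (n ∸ suc (toℕ m))) ∎
  where open ≡-Reasoning

W≡sum : ∀ s q → 0 < q → W s 0 0 q ≡ ∑[ r ≔ 0 ⋯ s ] (s C r) * ((q + r ∸ 1) C r) * (r !) * d (s ∸ r)
-- With `q` in the form `suc p`, the upper index `q + r ∸ 1` computes to `p + r`.
W≡sum s (suc p) _ = begin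
  W s 0 0 (suc p)
    ≡⟨ W-shuffle s 0 0 (suc p) ⟩
  shuffle s (rising (suc p)) (λ i → W i 0 0 0)
    ≡⟨ shuffle-cong s (rising≡C*! p) (λ i → sym (FixedPoints.d≡W i)) ⟩
  shuffle s (λ r → ((p + r) C r) * r !) d
    ≡⟨ shuffle≡sum s _ d ⟩
  sumUpTo (suc s) (λ r → (s C r) * (((p + r) C r) * r !) * d (s ∸ r))
    ≡⟨ sumUpTo-cong (suc s) (λ r _ → cong (_* d (s ∸ r)) (sym (*-assoc (s C r) ((p + r) C r) (r !)))) ⟩
  sumUpTo (suc s) (λ r → (s C r) * ((p + r) C r) * r ! * d (s ∸ r)) ∎
  where open ≡-Reasoning

theorem6p4 : (n : ℕ) → 1 ≤ n →
    length (𝒮-avoiding n ⟨32⨾1→1⟩) ≡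
    d n + d (n ∸ 1) +
    (∑[ m ≔ 1 ⋯ n ∸ 1 ] ∑[ r ≔ 0 ⋯ m ∸ 1 ]
    ((m ∸ 1) C r) * ((n ∸ m + r ∸ 1) C r) * (r !) * d (m ∸ 1 ∸ r))
theorem6p4 (suc N) _ = begin
  length (𝒮-avoiding (suc N) ⟨32⨾1→1⟩)
    ≡⟨ length-𝒮-avoiding (suc N) ⟩
  W (suc N) 0 0 0 + sumFin {suc N} (λ m → W (toℕ m) 0 0 (N ∸ toℕ m))
    -- The last summand belongs to the largest entry as pivot: nothing lies after it, and
    -- `W N 0 0 0` is `d N`.
    ≡⟨ cong (W (suc N) 0 0 0 +_) (trans (sumFin-toℕ (suc N) (λ i → W i 0 0 (N ∸ i))) (sumUpTo-last N _)) ⟩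
  W (suc N) 0 0 0 + (sumUpTo N (λ i → W i 0 0 (N ∸ i)) + W N 0 0 (N ∸ N))
    ≡⟨ cong (W (suc N) 0 0 0 +_) (+-comm (sumUpTo N (λ i → W i 0 0 (N ∸ i))) _) ⟩
  W (suc N) 0 0 0 + (W N 0 0 (N ∸ N) + sumUpTo N (λ i → W i 0 0 (N ∸ i)))
    ≡⟨ +-assoc (W (suc N) 0 0 0) _ _ ⟨
  W (suc N) 0 0 0 + W N 0 0 (N ∸ N) + sumUpTo N (λ i → W i 0 0 (N ∸ i))
    ≡⟨ cong₂ _+_ (cong₂ _+_ (sym (FixedPoints.d≡W (suc N)))
         (trans (cong (W N 0 0) (n∸n≡0 N)) (sym (FixedPoints.d≡W N))))
         (sumUpTo-cong N (λ i i<N → W≡sum i (N ∸ i) (m<n⇒0<n∸m i<N))) ⟩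
  -- For `m` equal to `1 + i`, the terms `m ∸ 1` and `suc N ∸ m` compute to `i` and `N ∸ i`, so the
  -- stated double sum is reached by computation.
  _ ∎
  where open ≡-Reasoning
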